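{- Let $n$ and $k$ be positive integers with $n \geq 2k \geq 4$. If $n \leq \frac{8}{3}k$, then $\chi_s(\mathrm{KG}(n,k)) = 2\chi(\mathrm{KG}(n,k)) - 2 = 2n-4k+2$.
   Context: For $n \geq 2k$, the Kneser graph $\mathrm{KG}(n,k)$ is the graph whose vertices are the $k$-element subsets of $[n]=\{1,\ldots,n\}$, two vertices $A,B$ being adjacent iff $A\cap B=\emptyset$; its chromatic number is $\chi(\mathrm{KG}(n,k)) = n-2k+2$. A star-free coloring of a graph $G$ is a proper coloring $c: V(G)\to\mathbb{N}$ such that no path on three vertices is colored with just two consecutive integers (i.e. there is no path $u,v,w$ with $\{c(u),c(v),c(w)\}=\{i,i+1\}$ for some $i$). The star-free chromatic number $\chi_s(G)$ is the minimum positive integer $t$ such that there is a star-free coloring $c: V(G)\to\{1,\ldots,t\}$. -}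

module Defs where

open import Data.Nat using (ℕ; suc; _≤_; _+_)
open import Data.Fin.Subset using (Subset; ∣_∣; _∩_; ⊥)
open import Data.Product using (Σ; _×_; ∃; proj₁)
open import Data.Sum using (_⊎_)
open import Relation.Binary.PropositionalEquality using (_≡_; _≢_)
open import Relation.Nullary using (¬_)

KVertex : ℕ → ℕ → Set
KVertex n k = Σ (Subset n) (λ A → ∣ A ∣ ≡ k)

KAdj : ∀ {n k} → KVertex n k → KVertex n k → Set
KAdj A B = proj₁ A ∩ proj₁ B ≡ ⊥

ColoringIn : ℕ → ℕ → ℕ → Set
ColoringIn n k t = Σ (KVertex n k → ℕ) (λ c → ∀ v → (1 ≤ c v) × (c v ≤ t))

Proper : ∀ {n k} → (KVertex n k → ℕ) → Set
Proper {n} {k} c = ∀ (u v : KVertex n k) → KAdj u v → c u ≢ c v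

ColorsAre : ℕ → ℕ → ℕ → ℕ → Set
ColorsAre a b d i =
  ((a ≡ i ⊎ a ≡ suc i) × (b ≡ i ⊎ b ≡ suc i) × (d ≡ i ⊎ d ≡ suc i))
  × ((a ≡ i ⊎ b ≡ i ⊎ d ≡ i) × (a ≡ suc i ⊎ b ≡ suc i ⊎ d ≡ suc i))

StarFree : ∀ {n k} → (KVertex n k → ℕ) → Set
StarFree {n} {k} c =
  Proper c ×
  (∀ (u v w : KVertex n k) → u ≢ v → v ≢ w → u ≢ w →
     KAdj u v → KAdj v w → ∀ i → ¬ ColorsAre (c u) (c v) (c w) i)

HasStarFreeColoring : ℕ → ℕ → ℕ → Set
HasStarFreeColoring n k t = Σ (ColoringIn n k t) (λ c → StarFree (proj₁ c))

StarChromaticNumberIs : ℕ → ℕ → ℕ → Set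
StarChromaticNumberIs n k t =
  (1 ≤ t) × HasStarFreeColoring n k t
  × (∀ t' → 1 ≤ t' → HasStarFreeColoring n k t' → t ≤ t')

{-# OPTIONS --safe #-}

-- Upper bound: give the sets with minimum i ≤ n − 2k the colours 1, 3, 5, …; the sets inside
-- the last 2k elements form a matching, so two consecutive colours suffice for them.
--
-- Lower bound, with m = n − 2k < k: suppose c is star-free with colours 1, …, 2m+1, and let
-- class j consist of the sets coloured 2j+1 or 2j+2. If two sets of class j lie in P and
-- P ∩ Q = ∅ then star-freeness forbids sets of class j inside Q. Hence each nonzero sign vector
-- X with sides P and Q can be labelled antipodally and without opposite labels on comparable
-- vectors: by its size if both sides have fewer than k elements; by ± a class having two
-- members in one side (it exists in a side of more than k elements, as there are m+1 ≤ k
-- classes) or a single member in a side of k elements and none in the other; and by one extra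
-- label if the sides are two k-sets A, B of the same class d. These are n labels, so by
-- Ky Fan's lemma some maximal chain carries all of them with alternating signs. Above (A , B)
-- in the chain every class other than d has two members in the side given by its sign. If c A =
-- 2d+1 and c B = 2d+2 and class d+1 has the sign of A, then B allows only one set of colour 2d+3
-- there, so colour 2d+4 occurs; repeating this with alternating sides, colour 2m+2 occurs,
-- which is absurd. The sign of the extra label is chosen to put class d+1 on the side of A.
--
-- Ky Fan's lemma: the number of maximal chains with alternating labels starting with + is odd,
-- by induction on the coordinates. By antipodality it is the number of chains in a closed
-- hemisphere alternating from either sign. A consistent label set alternates (from + or −) iff
-- deleting one label in turn leaves an odd number of sets alternating from +. Deleted inner
-- vertices of chains cancel in pairs, and only the chains of the equator remain.
module Submission where

open import Defs
open import Axiom.UniquenessOfIdentityProofs.WithK using (uip)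
open import Data.Bool using (Bool; true; false; not; _∧_; _xor_; if_then_else_)
open import Data.Bool.Properties
  using (not-involutive; not-¬; ¬-not; ∧-comm; ∧-assoc; ∧-zeroʳ; ∧-distribˡ-xor; xor-same; xor-assoc; xor-identityʳ)
  renaming (_≟_ to _≟B_)
open import Data.Bool.Solver using (module xor-∧-Solver)
open import Data.Empty using (⊥; ⊥-elim)
open import Data.Fin using (Fin; zero; suc; toℕ; fromℕ<)
open import Data.Fin.Properties using (toℕ-fromℕ<; fromℕ<-injective; pigeonhole)
  renaming (_≟_ to _≟F_; <⇒≢ to Fin-<⇒≢)
open import Data.Fin.Subset using (Subset; inside; outside; ∣_∣; _∩_; ∁; _⊆_)
  renaming (⊥ to ∅; _∈_ to _∈S_)
open import Data.Fin.Subset.Properties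
  using (∩-comm; Empty-unique; x∈p∩q⁻; p⊆q⇒∣p∣≤∣q∣; drop-∷-⊆; out⊆; in⊆in; ⊆-refl; ⊆-trans; ⊆-reflexive)
open import Data.List using (List; []; _∷_; length; allFin)
open import Data.List.Membership.Propositional using (_∈_)
open import Data.List.Properties using (length-tabulate)
open import Data.List.Relation.Unary.All as All using (All; []; _∷_)
open import Data.List.Relation.Unary.AllPairs using ([]; _∷_)
open import Data.List.Relation.Unary.Any using (here; there)
open import Data.List.Relation.Unary.Unique.Propositional using (Unique)
open import Data.List.Relation.Unary.Unique.Propositional.Properties using (allFin⁺)
open import Data.Maybe as Maybe using (Maybe; just; nothing; is-nothing)
open import Data.Nat using (ℕ; zero; suc; pred; ⌊_/2⌋; _+_; _*_; _∸_; _≤_; _<_; z≤n; s≤s; z<s; s≤s⁻¹)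
open import Data.Nat.Properties
open import Data.Nat.Tactic.RingSolver using (solve-∀)
open import Data.Product using (_×_; _,_; Σ; ∃; ∃₂; proj₁; proj₂)
open import Data.Sum as Sum using (_⊎_; inj₁; inj₂)
open import Data.Vec using (Vec; []; _∷_; here; lookup; map; replicate; _[_]≔_)
open import Data.Vec.Properties
  using (∷-injectiveˡ; ∷-injectiveʳ; lookup∘update; lookup∘update′; lookup-map; lookup-replicate; map-[]≔;
         []≔-commutes; []=⇒lookup; lookup⇒[]=)
open import Function using (_∘_; id; case_of_)
open import Relation.Binary.Definitions using (tri<; tri≈; tri>)
open import Relation.Binary.PropositionalEquality
open import Relation.Nullary using (Dec; ¬_; yes; no; contradiction)
open ≡-Reasoning

private variable
  I   : Set
  n N : ℕ

-- Sums modulo 2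

⨁ : List I → (I → Bool) → Bool
⨁ []       f = false
⨁ (x ∷ xs) f = f x xor ⨁ xs f

⨁-cong : ∀ {f g : I → Bool} (xs : List I) → (∀ x → f x ≡ g x) → ⨁ xs f ≡ ⨁ xs g
⨁-cong []       e = refl
⨁-cong (x ∷ xs) e = cong₂ _xor_ (e x) (⨁-cong xs e)

⨁-congAll : ∀ {P : I → Set} {f g : I → Bool} {xs} → All P xs → (∀ x → P x → f x ≡ g x) → ⨁ xs f ≡ ⨁ xs g
⨁-congAll []         e = refl
⨁-congAll (px ∷ pxs) e = cong₂ _xor_ (e _ px) (⨁-congAll pxs e)

⨁-witness : ∀ (xs : List I) {f} → ⨁ xs f ≡ true → ∃ λ x → f x ≡ true
⨁-witness (x ∷ xs) {f} e with f x in eq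
... | true  = x , eq
... | false = ⨁-witness xs e

⨁-false : (xs : List I) → ⨁ xs (λ _ → false) ≡ false
⨁-false []       = refl
⨁-false (x ∷ xs) = ⨁-false xs

xor-interchange : ∀ a b c d → (a xor b) xor (c xor d) ≡ (a xor c) xor (b xor d)
xor-interchange = solve 4 (λ a b c d → ((a :+ b) :+ (c :+ d)) := ((a :+ c) :+ (b :+ d))) refl
  where open xor-∧-Solver

xor-cancelˡ : ∀ a b → a xor (a xor b) ≡ b
xor-cancelˡ a b = trans (sym (xor-assoc a a b)) (cong (_xor b) (xor-same a))

⨁-xor : ∀ (xs : List I) (f g : I → Bool) → ⨁ xs (λ x → f x xor g x) ≡ ⨁ xs f xor ⨁ xs g
⨁-xor []       f g = refl
⨁-xor (x ∷ xs) f g = trans (cong ((f x xor g x) xor_) (⨁-xor xs f g)) (xor-interchange (f x) (g x) _ _)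

∧-⨁ : ∀ b (xs : List I) (f : I → Bool) → b ∧ ⨁ xs f ≡ ⨁ xs (λ x → b ∧ f x)
∧-⨁ b []       f = ∧-zeroʳ b
∧-⨁ b (x ∷ xs) f = trans (∧-distribˡ-xor b (f x) _) (cong ((b ∧ f x) xor_) (∧-⨁ b xs f))

-- The off-diagonal terms cancel in pairs h x y, h y x modulo 2.
⨁-symmetric : ∀ (xs : List I) (h : I → I → Bool) → (∀ x y → h x y ≡ h y x) → (∀ x → h x x ≡ false) →
  ⨁ xs (λ x → ⨁ xs (h x)) ≡ false
⨁-symmetric []       h symm diag = refl
⨁-symmetric (x ∷ xs) h symm diag = begin
  (h x x xor ⨁ xs (h x)) xor ⨁ xs (λ y → h y x xor ⨁ xs (h y))
    ≡⟨ cong₂ (λ a b → (a xor ⨁ xs (h x)) xor b) (diag x) (⨁-xor xs (λ y → h y x) (λ y → ⨁ xs (h y))) ⟩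
  ⨁ xs (h x) xor (⨁ xs (λ y → h y x) xor ⨁ xs (λ y → ⨁ xs (h y)))
    ≡⟨ cong (λ a → ⨁ xs (h x) xor (a xor ⨁ xs (λ y → ⨁ xs (h y)))) (⨁-cong xs (λ y → symm y x)) ⟩
  ⨁ xs (h x) xor (⨁ xs (h x) xor ⨁ xs (λ y → ⨁ xs (h y)))
    ≡⟨ xor-cancelˡ (⨁ xs (h x)) _ ⟩
  ⨁ xs (λ y → ⨁ xs (h y))
    ≡⟨ ⨁-symmetric xs h symm diag ⟩
  false ∎

∧-congʳ-true : ∀ b {x y} → (b ≡ true → x ≡ y) → b ∧ x ≡ b ∧ y
∧-congʳ-true true  e = e refl
∧-congʳ-true false e = refl

flips : ℕ → Bool → Bool
flips zero    s = s
flips (suc i) s = not (flips i s)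

flips-not : ∀ i s → flips i (not s) ≡ not (flips i s)
flips-not zero    s = refl
flips-not (suc i) s = cong not (flips-not i s)

-- Multisets of signed labels and alternating multisets

Label : ℕ → Set
Label N = Fin N × Bool

opposite : Label N → Label N
opposite (j , s) = j , not s

opposite-involutive : (l : Label N) → opposite (opposite l) ≡ l
opposite-involutive (j , s) = cong (j ,_) (not-involutive s)

-- At index j the multiplicities of +j and of −j.
Labels : ℕ → Set
Labels N = Vec (ℕ × ℕ) N

multiplicity : Labels N → Label N → ℕ
multiplicity v (j , true)  = proj₁ (lookup v j)
multiplicity v (j , false) = proj₂ (lookup v j)

none : Labels N
none = replicate _ (0 , 0)

add : Label N → Labels N → Labels N
add (zero  , true)  ((c , d) ∷ v) = (suc c , d) ∷ v
add (zero  , false) ((c , d) ∷ v) = (c , suc d) ∷ v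
add (suc j , s)     (e ∷ v)       = e ∷ add (j , s) v

total : Labels N → ℕ
total []            = 0
total ((c , d) ∷ v) = (c + d) + total v

swapSigns : Labels N → Labels N
swapSigns = map (λ (c , d) → d , c)

total-none : ∀ N → total (none {N}) ≡ 0
total-none zero    = refl
total-none (suc N) = total-none N

total-add : ∀ (l : Label N) v → total (add l v) ≡ suc (total v)
total-add (zero  , true)  ((c , d) ∷ v) = refl
total-add (zero  , false) ((c , d) ∷ v) = cong (_+ total v) (+-suc c d)
total-add (suc j , s)     ((c , d) ∷ v) = trans (cong ((c + d) +_) (total-add (j , s) v)) (+-suc (c + d) (total v))

multiplicity-none : (l : Label N) → multiplicity none l ≡ 0
multiplicity-none (j , true)  = cong proj₁ (lookup-replicate j (0 , 0))
multiplicity-none (j , false) = cong proj₂ (lookup-replicate j (0 , 0))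

multiplicity-add : ∀ (l l′ : Label N) v → 0 < multiplicity (add l v) l′ → l′ ≡ l ⊎ 0 < multiplicity v l′
multiplicity-add (zero  , true)  (zero  , true)  (e ∷ v) p = inj₁ refl
multiplicity-add (zero  , true)  (zero  , false) (e ∷ v) p = inj₂ p
multiplicity-add (zero  , false) (zero  , true)  (e ∷ v) p = inj₂ p
multiplicity-add (zero  , false) (zero  , false) (e ∷ v) p = inj₁ refl
multiplicity-add (zero  , true)  (suc i , true)  (e ∷ v) p = inj₂ p
multiplicity-add (zero  , true)  (suc i , false) (e ∷ v) p = inj₂ p
multiplicity-add (zero  , false) (suc i , true)  (e ∷ v) p = inj₂ p
multiplicity-add (zero  , false) (suc i , false) (e ∷ v) p = inj₂ p
multiplicity-add (suc j , s)     (zero  , true)  (e ∷ v) p = inj₂ p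
multiplicity-add (suc j , s)     (zero  , false) (e ∷ v) p = inj₂ p
multiplicity-add (suc j , s)     (suc i , true)  (e ∷ v) p with multiplicity-add (j , s) (i , true) v p
... | inj₁ refl = inj₁ refl
... | inj₂ q    = inj₂ q
multiplicity-add (suc j , s)     (suc i , false) (e ∷ v) p with multiplicity-add (j , s) (i , false) v p
... | inj₁ refl = inj₁ refl
... | inj₂ q    = inj₂ q

swapSigns-none : ∀ N → swapSigns (none {N}) ≡ none
swapSigns-none zero    = refl
swapSigns-none (suc N) = cong ((0 , 0) ∷_) (swapSigns-none N)

swapSigns-add : ∀ (l : Label N) v → swapSigns (add l v) ≡ add (opposite l) (swapSigns v)
swapSigns-add (zero  , true)  (e ∷ v) = refl
swapSigns-add (zero  , false) (e ∷ v) = refl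
swapSigns-add (suc j , s)     (e ∷ v) = cong (_ ∷_) (swapSigns-add (j , s) v)

odd : ℕ → Bool
odd zero    = false
odd (suc m) = not (odd m)

-- The sum modulo 2 of h over all ways of removing one label.
∂ : (Labels N → Bool) → Labels N → Bool
∂ h []            = false
∂ h ((c , d) ∷ v) =
  (odd c ∧ h ((pred c , d) ∷ v)) xor ((odd d ∧ h ((c , pred d) ∷ v)) xor ∂ (λ w → h ((c , d) ∷ w)) v)

∂-false : (v : Labels N) → ∂ (λ _ → false) v ≡ false
∂-false []            = refl
∂-false ((c , d) ∷ v) = cong₂ _xor_ (∧-zeroʳ (odd c)) (cong₂ _xor_ (∧-zeroʳ (odd d)) (∂-false v))

∂-none : ∀ N (h : Labels N → Bool) → ∂ h none ≡ false
∂-none zero    h = refl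
∂-none (suc N) h = ∂-none N _

∂-xor : ∀ (f g : Labels N → Bool) v → ∂ (λ w → f w xor g w) v ≡ ∂ f v xor ∂ g v
∂-xor f g []            = refl
∂-xor f g ((c , d) ∷ v) = trans
  (cong (λ z → (odd c ∧ (f c′ xor g c′)) xor ((odd d ∧ (f d′ xor g d′)) xor z)) (∂-xor (λ w → f ((c , d) ∷ w)) _ v))
  (rearrange (odd c) (f c′) (g c′) (odd d) (f d′) (g d′) _ _)
  where
  c′ = (pred c , d) ∷ v
  d′ = (c , pred d) ∷ v
  rearrange : ∀ p a b q x y u w → (p ∧ (a xor b)) xor ((q ∧ (x xor y)) xor (u xor w))
    ≡ ((p ∧ a) xor ((q ∧ x) xor u)) xor ((p ∧ b) xor ((q ∧ y) xor w))
  rearrange = solve 8 (λ p a b q x y u w → ((p :* (a :+ b)) :+ ((q :* (x :+ y)) :+ (u :+ w)))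
    := (((p :* a) :+ ((q :* x) :+ u)) :+ ((p :* b) :+ ((q :* y) :+ w)))) refl
    where open xor-∧-Solver

∂-∧ : ∀ b (h : Labels N → Bool) v → ∂ (λ w → b ∧ h w) v ≡ b ∧ ∂ h v
∂-∧ true  h v = refl
∂-∧ false h v = ∂-false v

∂-⨁ : ∀ (xs : List I) (b : I → Bool) (h : I → Labels N → Bool) v →
  ∂ (λ w → ⨁ xs (λ x → b x ∧ h x w)) v ≡ ⨁ xs (λ x → b x ∧ ∂ (h x) v)
∂-⨁ []       b h v = ∂-false v
∂-⨁ (x ∷ xs) b h v = trans (∂-xor (λ w → b x ∧ h x w) _ v) (cong₂ _xor_ (∂-∧ (b x) (h x) v) (∂-⨁ xs b h v))

-- A product rule: removing the new copy of `l` restores `v`, and removing an older label commutes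
-- with adding `l`.
∂-add : ∀ (l : Label N) (h : Labels N → Bool) v → ∂ h (add l v) ≡ h v xor ∂ (h ∘ add l) v
∂-add (zero , true) h ((c , d) ∷ v) = lemma c (λ c′ → h ((c′ , d) ∷ v)) _
  where
  lemma : ∀ c (f : ℕ → Bool) z →
    (not (odd c) ∧ f c) xor z ≡ f c xor ((odd c ∧ f (suc (pred c))) xor z)
  -- `suc (pred 0)` is 1 and not 0, but its weight `odd 0` is false.
  lemma zero    f z = refl
  lemma (suc c) f z = solve 3 (λ p a z → (((con true :+ p) :* a) :+ z) := (a :+ ((p :* a) :+ z))) refl
    (odd (suc c)) (f (suc c)) z
    where open xor-∧-Solver
∂-add (zero , false) h ((c , d) ∷ v) = lemma d (λ d′ → h ((c , d′) ∷ v)) (odd c ∧ h ((pred c , suc d) ∷ v)) _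
  where
  lemma : ∀ d (f : ℕ → Bool) y z →
    y xor ((not (odd d) ∧ f d) xor z) ≡ f d xor (y xor ((odd d ∧ f (suc (pred d))) xor z))
  lemma zero    f y z = solve 3 (λ a y z → (y :+ (a :+ z)) := (a :+ (y :+ z))) refl (f 0) y z
    where open xor-∧-Solver
  lemma (suc d) f y z = solve 4 (λ p a y z → (y :+ (((con true :+ p) :* a) :+ z)) := (a :+ (y :+ ((p :* a) :+ z)))) refl
    (odd (suc d)) (f (suc d)) y z
    where open xor-∧-Solver
∂-add (suc j , s) h ((c , d) ∷ v) = begin
  p xor (q xor ∂ h′ (add (j , s) v))
    ≡⟨ cong (λ z → p xor (q xor z)) (∂-add (j , s) h′ v) ⟩
  p xor (q xor (h′ v xor ∂ (h′ ∘ add (j , s)) v))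
    ≡⟨ solve 4 (λ p q a z → (p :+ (q :+ (a :+ z))) := (a :+ (p :+ (q :+ z)))) refl p q (h′ v) _ ⟩
  h′ v xor (p xor (q xor ∂ (h′ ∘ add (j , s)) v)) ∎
  where
  open xor-∧-Solver
  h′ = λ w → h ((c , d) ∷ w)
  p = odd c ∧ h ((pred c , d) ∷ add (j , s) v)
  q = odd d ∧ h ((c , pred d) ∷ add (j , s) v)

-- Holds when the labels are distinct in absolute value and, listed by increasing
-- absolute value, alternate in sign starting with s.
alternating : Bool → Labels N → Bool
alternating s []                            = true
alternating s ((0 , 0) ∷ v)                 = alternating s v
alternating s ((1 , 0) ∷ v)                 = s ∧ alternating (not s) v
alternating s ((0 , 1) ∷ v)                 = not s ∧ alternating (not s) v
alternating s ((0 , suc (suc _)) ∷ v)       = false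
alternating s ((1 , suc _) ∷ v)             = false
alternating s ((suc (suc _) , _) ∷ v)       = false

alternating-none : ∀ N s → alternating s (none {N}) ≡ true
alternating-none zero    s = refl
alternating-none (suc N) s = alternating-none N s

alternating-swapSigns : ∀ s (v : Labels N) → alternating s (swapSigns v) ≡ alternating (not s) v
alternating-swapSigns s []                                  = refl
alternating-swapSigns s ((0 , 0) ∷ v)                       = alternating-swapSigns s v
alternating-swapSigns s ((1 , 0) ∷ v)                       = cong (not s ∧_) (alternating-swapSigns (not s) v)
alternating-swapSigns s ((0 , 1) ∷ v)                       =
  cong₂ _∧_ (sym (not-involutive s)) (alternating-swapSigns (not s) v)
alternating-swapSigns s ((0 , suc (suc _)) ∷ v)             = refl
alternating-swapSigns s ((1 , 1) ∷ v)                       = refl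
alternating-swapSigns s ((1 , suc (suc _)) ∷ v)             = refl
alternating-swapSigns s ((suc (suc _) , 0) ∷ v)             = refl
alternating-swapSigns s ((suc (suc _) , 1) ∷ v)             = refl
alternating-swapSigns s ((suc (suc _) , suc (suc _)) ∷ v)   = refl

Consistent : Labels N → Set
Consistent v = ∀ j → ¬ (0 < multiplicity v (j , true) × 0 < multiplicity v (j , false))

-- From a nonempty set alternating from `s`, only deleting the last label leaves one alternating
-- from `s`; from one alternating from the other sign, only deleting the first does. The empty set
-- alternates from both signs and has nothing to delete. In every other consistent set the deletions
-- that leave an alternating set come in pairs. Without consistency the identity fails, for example
-- on +j and -j alone.
∂-alternating : ∀ s (v : Labels N) → Consistent v → ∂ (alternating s) v ≡ alternating s v xor alternating (not s) v
∂-alternating s []                          ok = refl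
∂-alternating s ((0 , 0) ∷ v)               ok = ∂-alternating s v (ok ∘ suc)
∂-alternating s ((1 , 0) ∷ v)               ok = begin
  alternating s v xor ∂ (λ w → s ∧ alternating (not s) w) v
    ≡⟨ cong (alternating s v xor_) (∂-∧ s (alternating (not s)) v) ⟩
  alternating s v xor (s ∧ ∂ (alternating (not s)) v)
    ≡⟨ cong (λ z → alternating s v xor (s ∧ z)) (∂-alternating (not s) v (ok ∘ suc)) ⟩
  alternating s v xor (s ∧ (alternating (not s) v xor alternating (not (not s)) v))
    ≡⟨ lemma s ⟩
  (s ∧ alternating (not s) v) xor (not s ∧ alternating (not (not s)) v) ∎
  where
  lemma : ∀ s → alternating s v xor (s ∧ (alternating (not s) v xor alternating (not (not s)) v))
    ≡ (s ∧ alternating (not s) v) xor (not s ∧ alternating (not (not s)) v)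
  lemma true  = solve 2 (λ a b → (a :+ (b :+ a)) := (b :+ con false)) refl (alternating true v) (alternating false v)
    where open xor-∧-Solver
  lemma false = xor-identityʳ _
∂-alternating s ((0 , 1) ∷ v)               ok = begin
  alternating s v xor ∂ (λ w → not s ∧ alternating (not s) w) v
    ≡⟨ cong (alternating s v xor_) (∂-∧ (not s) (alternating (not s)) v) ⟩
  alternating s v xor (not s ∧ ∂ (alternating (not s)) v)
    ≡⟨ cong (λ z → alternating s v xor (not s ∧ z)) (∂-alternating (not s) v (ok ∘ suc)) ⟩
  alternating s v xor (not s ∧ (alternating (not s) v xor alternating (not (not s)) v))
    ≡⟨ lemma s ⟩
  (not s ∧ alternating (not s) v) xor (not (not s) ∧ alternating (not (not s)) v) ∎
  where
  lemma : ∀ s → alternating s v xor (not s ∧ (alternating (not s) v xor alternating (not (not s)) v))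
    ≡ (not s ∧ alternating (not s) v) xor (not (not s) ∧ alternating (not (not s)) v)
  lemma true  = xor-identityʳ _
  lemma false = solve 2 (λ a b → (a :+ (b :+ a)) := (b :+ con false)) refl (alternating false v) (alternating true v)
    where open xor-∧-Solver
∂-alternating s ((0 , 2) ∷ v)               ok = ∂-false v
∂-alternating s ((0 , suc (suc (suc d))) ∷ v) ok =
  cong₂ _xor_ (∧-zeroʳ (not (not (not (odd d))))) (∂-false v)
∂-alternating s ((suc c , suc d) ∷ v)       ok = ⊥-elim (ok zero (z<s , z<s))
∂-alternating s ((2 , 0) ∷ v)               ok = ∂-false v
∂-alternating s ((suc (suc (suc c)) , 0) ∷ v) ok =
  cong₂ _xor_ (∧-zeroʳ (not (not (not (odd c))))) (∂-false v)

alternating-total : ∀ s (v : Labels N) → alternating s v ≡ true → total v ≤ N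
alternating-total s     []            a = z≤n
alternating-total s     ((0 , 0) ∷ v) a = m≤n⇒m≤1+n (alternating-total s v a)
alternating-total true  ((1 , 0) ∷ v) a = s≤s (alternating-total false v a)
alternating-total false ((0 , 1) ∷ v) a = s≤s (alternating-total true v a)

-- An alternating set has at most one label per index, so N labels leave no index empty and the
-- signs are forced.
alternating-full : ∀ s (v : Labels N) → alternating s v ≡ true → N ≤ total v →
  ∀ j → 0 < multiplicity v (j , flips (toℕ j) s)
alternating-full s     ((0 , 0) ∷ v) a N≤ j       = contradiction (alternating-total s v a) (<⇒≱ N≤)
alternating-full true  ((1 , 0) ∷ v) a N≤ zero    = z<s
alternating-full false ((0 , 1) ∷ v) a N≤ zero    = z<s
alternating-full true  ((1 , 0) ∷ v) a (s≤s N≤) (suc j)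
  with alternating-full false v a N≤ j
-- `multiplicity` computes only at a literal sign, hence the split on the sign.
... | p rewrite flips-not (toℕ j) true with flips (toℕ j) true
...   | true  = p
...   | false = p
alternating-full false ((0 , 1) ∷ v) a (s≤s N≤) (suc j)
  with alternating-full true v a N≤ j
... | p rewrite flips-not (toℕ j) false with flips (toℕ j) false
...   | true  = p
...   | false = p

-- Sign vectors and maximal chains

SignVector : ℕ → Set
SignVector = Vec (Maybe Bool)

0̂ : SignVector n
0̂ = replicate _ nothing

neg : SignVector n → SignVector n
neg = map (Maybe.map not)

infix 4 _⊑_
_⊑_ : SignVector n → SignVector n → Set
X ⊑ Y = ∀ {i s} → lookup X i ≡ just s → lookup Y i ≡ just s

first : SignVector n → Maybe Bool
first []            = nothing
first (nothing ∷ X) = first X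
first (just s  ∷ X) = just s

Nonzero : SignVector n → Set
Nonzero X = ∃ λ s → first X ≡ just s

first-neg : (X : SignVector n) → first (neg X) ≡ Maybe.map not (first X)
first-neg []            = refl
first-neg (nothing ∷ X) = first-neg X
first-neg (just s  ∷ X) = refl

neg-involutive : (X : SignVector n) → neg (neg X) ≡ X
neg-involutive []            = refl
neg-involutive (nothing ∷ X) = cong (nothing ∷_) (neg-involutive X)
neg-involutive (just s  ∷ X) = cong₂ _∷_ (cong just (not-involutive s)) (neg-involutive X)

neg-0̂ : ∀ n → neg (0̂ {n}) ≡ 0̂
neg-0̂ zero    = refl
neg-0̂ (suc n) = cong (nothing ∷_) (neg-0̂ n)

Move : ℕ → Set
Move n = Fin n × Bool

free : SignVector n → Move n → Bool
free X (i , _) = is-nothing (lookup X i)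

go : SignVector n → Move n → SignVector n
go X (i , s) = X [ i ]≔ just s

go-Nonzero : ∀ (X : SignVector n) p → Nonzero (go X p)
go-Nonzero (x ∷ X)       (zero  , s) = s , refl
go-Nonzero (nothing ∷ X) (suc i , s) = go-Nonzero X (i , s)
go-Nonzero (just t ∷ X)  (suc i , s) = t , refl

free-nothing : ∀ (X : SignVector n) p → free X p ≡ true → lookup X (proj₁ p) ≡ nothing
free-nothing X (i , s) e with lookup X i
... | nothing = refl

go-stays : ∀ (X : SignVector n) {i t} p → free X p ≡ true → lookup X i ≡ just t → lookup (go X p) i ≡ just t
go-stays X {i} (j , s) f e with i ≟F j
... | yes refl = case trans (sym e) (free-nothing X (j , s) f) of λ ()
... | no  i≢j  = trans (lookup∘update′ i≢j X (just s)) e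

neg-free : ∀ (X : SignVector n) p → free (neg X) p ≡ free X p
neg-free X (i , s) rewrite lookup-map i (Maybe.map not) X with lookup X i
... | nothing = refl
... | just _  = refl

-- The list of permitted moves selects the region: `moves is` gives the sphere on the coordinates
-- `is`, and one further move at a new coordinate gives a closed hemisphere whose equator is that
-- sphere.
moves : List (Fin n) → List (Move n)
moves []       = []
moves (i ∷ is) = (i , true) ∷ (i , false) ∷ moves is

moves-All : ∀ {P : Fin n → Set} {is} → All P is → All (P ∘ proj₁) (moves is)
moves-All []         = []
moves-All (px ∷ pxs) = px ∷ px ∷ moves-All pxs

blank : Maybe Bool → ℕ
blank nothing  = 1
blank (just _) = 0

blanks : List (Fin n) → SignVector n → ℕ
blanks []       X = 0
blanks (i ∷ is) X = blank (lookup X i) + blanks is X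

blanks≤length : ∀ (is : List (Fin n)) X → blanks is X ≤ length is
blanks≤length []       X = z≤n
blanks≤length (i ∷ is) X with lookup X i
... | nothing = s≤s (blanks≤length is X)
... | just _  = m≤n⇒m≤1+n (blanks≤length is X)

blank-go : ∀ (X : SignVector n) i p → blank (lookup (go X p) i) ≤ blank (lookup X i)
blank-go X i (j , s) with i ≟F j
... | yes refl rewrite lookup∘update i X (just s) = z≤n
... | no  i≢j  rewrite lookup∘update′ i≢j X (just s) = ≤-refl

blanks-go : ∀ (is : List (Fin n)) X p → blanks is (go X p) ≤ blanks is X
blanks-go []       X p = z≤n
blanks-go (i ∷ is) X p = +-mono-≤ (blank-go X i p) (blanks-go is X p)

blanks-go-head : ∀ i (is : List (Fin n)) X s → free X (i , s) ≡ true → blanks (i ∷ is) (go X (i , s)) < blanks (i ∷ is) X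
blanks-go-head i is X s f rewrite lookup∘update i X (just s) | free-nothing X (i , s) f = s≤s (blanks-go is X (i , s))

blanks-go-< : ∀ (is : List (Fin n)) X → All (λ p → free X p ≡ true → blanks is (go X p) < blanks is X) (moves is)
blanks-go-< []       X = []
blanks-go-< (i ∷ is) X = blanks-go-head i is X true ∷ blanks-go-head i is X false ∷
  All.map (λ {p} lt f → ≤-trans (≤-reflexive (sym (+-suc _ _))) (+-mono-≤ (blank-go X i p) (lt f))) (blanks-go-< is X)

-- Ky Fan's lemma for an antipodal labelling

module AntipodalLabelling (label : SignVector n → Label N)
  (label-neg : ∀ X → Nonzero X → label (neg X) ≡ opposite (label X))
  (no-opposite : ∀ X Y → Nonzero X → X ⊑ Y → label Y ≢ opposite (label X)) where

  -- Evaluated at the current end of a chain and at the labels collected so far.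
  Observable : Set
  Observable = SignVector n → Labels N → Bool

  step : List (Move n) → Observable → Observable
  step ms g X v = ⨁ ms (λ p → free X p ∧ g (go X p) (add (label (go X p)) v))

  unlabelledStep : List (Move n) → Observable → Observable
  unlabelledStep ms g X v = ⨁ ms (λ p → free X p ∧ g (go X p) v)

  -- The sum modulo 2 of g over all chains of r moves, each recording the label it reaches.
  steps : List (Move n) → ℕ → Observable → Observable
  steps ms zero    g = g
  steps ms (suc r) g = step ms (steps ms r g)

  step-cong : ∀ ms {g g′ : Observable} → (∀ X v → g X v ≡ g′ X v) → ∀ X v → step ms g X v ≡ step ms g′ X v
  step-cong ms e X v = ⨁-cong ms (λ p → cong (free X p ∧_) (e (go X p) (add (label (go X p)) v)))

  step-xor : ∀ ms (g g′ : Observable) X v →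
    step ms (λ X v → g X v xor g′ X v) X v ≡ step ms g X v xor step ms g′ X v
  step-xor ms g g′ X v = trans (⨁-cong ms (λ p → ∧-distribˡ-xor (free X p) _ _)) (⨁-xor ms _ _)

  steps-xor : ∀ ms r (g g′ : Observable) X v →
    steps ms r (λ X v → g X v xor g′ X v) X v ≡ steps ms r g X v xor steps ms r g′ X v
  steps-xor ms zero    g g′ X v = refl
  steps-xor ms (suc r) g g′ X v = trans (step-cong ms (steps-xor ms r g g′) X v) (step-xor ms (steps ms r g) (steps ms r g′) X v)

  -- Two moves commute, so chains with an inner vertex left unlabelled cancel in pairs.
  unlabelledStep-step : ∀ ms g X v → unlabelledStep ms (step ms g) X v ≡ false
  unlabelledStep-step ms g X v = trans
    (⨁-cong ms (λ p → trans (∧-⨁ (free X p) ms _) (⨁-cong ms (λ q → sym (∧-assoc (free X p) _ _)))))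
    (⨁-symmetric ms _ symm diag)
    where
    val : SignVector n → Bool
    val Z = g Z (add (label Z) v)
    diag : ∀ p → (free X p ∧ free (go X p) p) ∧ val (go (go X p) p) ≡ false
    diag (i , s) rewrite lookup∘update i X (just s) | ∧-zeroʳ (is-nothing (lookup X i)) = refl
    symm : ∀ p q → (free X p ∧ free (go X p) q) ∧ val (go (go X p) q) ≡ (free X q ∧ free (go X q) p) ∧ val (go (go X q) p)
    symm (i , s) (j , t) with i ≟F j
    ... | yes refl rewrite lookup∘update i X (just s) | lookup∘update i X (just t)
                         | ∧-zeroʳ (is-nothing (lookup X i)) = refl
    ... | no i≢j   rewrite lookup∘update′ i≢j X (just t) | lookup∘update′ (i≢j ∘ sym) X (just s) =
      cong₂ (λ a Z → a ∧ val Z) (∧-comm (is-nothing (lookup X i)) _) ([]≔-commutes X i j i≢j)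

  -- By `∂-add`, the label removed is either the one just recorded, which amounts to an unlabelled
  -- step, or an earlier one.
  step-∂ : ∀ ms g X v → step ms (λ X → ∂ (g X)) X v ≡ unlabelledStep ms g X v xor ∂ (step ms g X) v
  step-∂ ms g X v = begin
    ⨁ ms (λ p → free X p ∧ ∂ (g (go X p)) (add (label (go X p)) v))
      ≡⟨ ⨁-cong ms (λ p → trans (cong (free X p ∧_) (∂-add (label (go X p)) (g (go X p)) v)) (∧-distribˡ-xor (free X p) _ _)) ⟩
    ⨁ ms (λ p → (free X p ∧ g (go X p) v) xor (free X p ∧ ∂ (g (go X p) ∘ add (label (go X p))) v))
      ≡⟨ ⨁-xor ms _ _ ⟩
    unlabelledStep ms g X v xor ⨁ ms (λ p → free X p ∧ ∂ (g (go X p) ∘ add (label (go X p))) v)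
      ≡⟨ cong (unlabelledStep ms g X v xor_) (sym (∂-⨁ ms (free X) (λ p → g (go X p) ∘ add (label (go X p))) v)) ⟩
    unlabelledStep ms g X v xor ∂ (step ms g X) v ∎

  -- Iterating `step-∂`: an unlabelled step before the last one is followed by a labelled step and
  -- cancels by `unlabelledStep-step`. Only the last vertex can remain unlabelled.
  steps-∂ : ∀ ms r g X v →
    steps ms (suc r) (λ X → ∂ (g X)) X v ≡ steps ms r (unlabelledStep ms g) X v xor ∂ (steps ms (suc r) g X) v
  steps-∂ ms zero    g X v = step-∂ ms g X v
  steps-∂ ms (suc r) g X v = begin
    step ms (steps ms (suc r) (λ X → ∂ (g X))) X v
      ≡⟨ step-cong ms (steps-∂ ms r g) X v ⟩
    step ms (λ X v → steps ms r (unlabelledStep ms g) X v xor ∂ (steps ms (suc r) g X) v) X v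
      ≡⟨ step-xor ms (steps ms r (unlabelledStep ms g)) (λ X → ∂ (steps ms (suc r) g X)) X v ⟩
    s₁ xor step ms (λ X → ∂ (steps ms (suc r) g X)) X v
      ≡⟨ cong (s₁ xor_) (step-∂ ms (steps ms (suc r) g) X v) ⟩
    s₁ xor (unlabelledStep ms (step ms (steps ms r g)) X v xor s₂)
      ≡⟨ cong (λ z → s₁ xor (z xor s₂)) (unlabelledStep-step ms (steps ms r g) X v) ⟩
    s₁ xor s₂ ∎
    where
    s₁ = steps ms (suc r) (unlabelledStep ms g) X v
    s₂ = ∂ (steps ms (suc (suc r)) g X) v

  -- Hemispheres, equator and reflection

  steps-blocked : ∀ ms r g X v {i s t} → lookup X i ≡ just t → steps ((i , s) ∷ ms) r g X v ≡ steps ms r g X v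
  steps-blocked ms zero    g X v         e = refl
  steps-blocked ms (suc r) g X v {i} {s} e rewrite e = ⨁-cong ms (λ p → ∧-congʳ-true (free X p)
    (λ f → steps-blocked ms r g (go X p) _ (go-stays X p f e)))

  -- Inclusion and exclusion: a chain moves at most once at coordinate `i`, so it lies in one
  -- hemisphere, or in both if it never moves there. The last term corrects this double count modulo
  -- 2.
  steps-split : ∀ ms r g X v {i} → All (λ p → i ≢ proj₁ p) ms → lookup X i ≡ nothing →
    steps ((i , true) ∷ (i , false) ∷ ms) r g X v
      ≡ steps ((i , true) ∷ ms) r g X v xor (steps ((i , false) ∷ ms) r g X v xor steps ms r g X v)
  steps-split ms zero    g X v i∉ e = sym (trans (cong (g X v xor_) (xor-same (g X v))) (xor-identityʳ (g X v)))
  steps-split ms (suc r) g X v {i} i∉ e rewrite e = begin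
    after both true xor (after both false xor ⨁ ms (rest both))
      ≡⟨ cong₂ (λ a b → a xor (b xor ⨁ ms (rest both)))
           (trans (blocked ((i , false) ∷ ms) true) (blocked ms true))
           (trans (blocked ((i , false) ∷ ms) false) (blocked ms false)) ⟩
    after ms true xor (after ms false xor ⨁ ms (rest both))
      ≡⟨ cong (λ z → after ms true xor (after ms false xor z)) inner ⟩
    after ms true xor (after ms false xor (S⁺ xor (S⁻ xor S)))
      ≡⟨ solve 5 (λ a b x y z → (a :+ (b :+ (x :+ (y :+ z)))) := ((a :+ x) :+ ((b :+ y) :+ z))) refl
           (after ms true) (after ms false) S⁺ S⁻ S ⟩
    (after ms true xor S⁺) xor ((after ms false xor S⁻) xor S)
      ≡⟨ cong₂ (λ a b → (a xor S⁺) xor ((b xor S⁻) xor S)) (sym (blocked ms true)) (sym (blocked ms false)) ⟩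
    (after (plus ms) true xor S⁺) xor ((after (minus ms) false xor S⁻) xor S) ∎
    where
    open xor-∧-Solver
    plus minus : List (Move n) → List (Move n)
    plus  = (i , true) ∷_
    minus = (i , false) ∷_
    both : List (Move n)
    both = plus (minus ms)
    after : List (Move n) → Bool → Bool
    after ms s = steps ms r g (go X (i , s)) (add (label (go X (i , s))) v)
    rest : List (Move n) → Move n → Bool
    rest ms p = free X p ∧ steps ms r g (go X p) (add (label (go X p)) v)
    S⁺ = ⨁ ms (rest (plus ms))
    S⁻ = ⨁ ms (rest (minus ms))
    S  = ⨁ ms (rest ms)
    blocked : ∀ ms s {t} → steps ((i , t) ∷ ms) r g (go X (i , s)) (add (label (go X (i , s))) v) ≡ after ms s
    blocked ms s = steps-blocked ms r g _ _ (lookup∘update i X (just s))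
    inner : ⨁ ms (rest both) ≡ S⁺ xor (S⁻ xor S)
    inner = begin
      ⨁ ms (rest both)
        ≡⟨ ⨁-congAll i∉ (λ p i≢ → trans
             (cong (free X p ∧_) (steps-split ms r g (go X p) _ i∉ (trans (lookup∘update′ i≢ X (just (proj₂ p))) e)))
             (trans (∧-distribˡ-xor (free X p) _ _) (cong (rest (plus ms) p xor_) (∧-distribˡ-xor (free X p) _ _)))) ⟩
      ⨁ ms (λ p → rest (plus ms) p xor (rest (minus ms) p xor rest ms p))
        ≡⟨ ⨁-xor ms _ _ ⟩
      S⁺ xor ⨁ ms (λ p → rest (minus ms) p xor rest ms p)
        ≡⟨ cong (S⁺ xor_) (⨁-xor ms _ _) ⟩
      S⁺ xor (S⁻ xor S) ∎

  vacant : Fin n → Observable → Observable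
  vacant i g X v = is-nothing (lookup X i) ∧ g X v

  steps-occupied : ∀ ms r g X v {i t} → lookup X i ≡ just t → steps ms r (vacant i g) X v ≡ false
  steps-occupied ms zero    g X v e rewrite e = refl
  steps-occupied ms (suc r) g X v e = trans (⨁-cong ms (λ p → trans (∧-congʳ-true (free X p)
    (λ f → steps-occupied ms r g (go X p) _ (go-stays X p f e))) (∧-zeroʳ (free X p)))) (⨁-false ms)

  steps-vacant : ∀ ms r g X v {i s} → All (λ p → i ≢ proj₁ p) ms → lookup X i ≡ nothing →
    steps ((i , s) ∷ ms) r (vacant i g) X v ≡ steps ms r g X v
  steps-vacant ms zero    g X v i∉ e rewrite e = refl
  steps-vacant ms (suc r) g X v {i} {s} i∉ e rewrite e = cong₂ _xor_
    (steps-occupied ((i , s) ∷ ms) r g (go X (i , s)) _ (lookup∘update i X (just s)))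
    (⨁-congAll i∉ (λ p i≢ → cong (free X p ∧_)
      (steps-vacant ms r g (go X p) _ i∉ (trans (lookup∘update′ i≢ X (just (proj₂ p))) e))))

  -- The observable ignores the vertex, so the two signs at each coordinate of `is` give equal
  -- terms; the single move at `i` has no partner.
  unlabelledStep-moves : ∀ i s is (h : Labels N → Bool) X v →
    unlabelledStep ((i , s) ∷ moves is) (λ _ → h) X v ≡ vacant i (λ _ → h) X v
  unlabelledStep-moves i s is h X v = trans (cong (vacant i (λ _ → h) X v xor_) (pairs is)) (xor-identityʳ _)
    where
    pairs : ∀ is → ⨁ (moves is) (λ p → free X p ∧ h v) ≡ false
    pairs []       = refl
    pairs (j ∷ is) = trans (xor-cancelˡ (free X (j , true) ∧ h v) _) (pairs is)

  -- Negating every vertex is a bijection between the chains of the two hemispheres, and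
  -- antipodality reverses all recorded labels. The two moves at each coordinate of `is` trade
  -- places.
  steps-neg : ∀ i s is r (g g′ : Observable) → (∀ X v → g X v ≡ g′ (neg X) (swapSigns v)) → ∀ X v →
    steps ((i , s) ∷ moves is) r g X v ≡ steps ((i , not s) ∷ moves is) r g′ (neg X) (swapSigns v)
  steps-neg i s is zero    g g′ e X v = e X v
  steps-neg i s is (suc r) g g′ e X v = cong₂ _xor_ (one (i , s)) (pairs is)
    where
    term : Move n → Bool
    term p = free X p ∧ steps ((i , s) ∷ moves is) r g (go X p) (add (label (go X p)) v)
    term′ : Move n → Bool
    term′ p = free (neg X) p ∧
      steps ((i , not s) ∷ moves is) r g′ (go (neg X) p) (add (label (go (neg X) p)) (swapSigns v))
    one : ∀ p → term p ≡ term′ (opposite p)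
    one p@(j , t)
      rewrite sym (map-[]≔ {x = just t} (Maybe.map not) X j)
            | label-neg (go X p) (go-Nonzero X p)
            | sym (swapSigns-add (label (go X p)) v)
            = cong₂ _∧_ (sym (neg-free X p)) (steps-neg i s is r g g′ e (go X p) _)
    pairs : ∀ is → ⨁ (moves is) term ≡ ⨁ (moves is) term′
    pairs []       = refl
    pairs (j ∷ is) = begin
      term (j , true) xor (term (j , false) xor ⨁ (moves is) term)
        ≡⟨ cong₂ _xor_ (one (j , true)) (cong₂ _xor_ (one (j , false)) (pairs is)) ⟩
      term′ (j , false) xor (term′ (j , true) xor ⨁ (moves is) term′)
        ≡⟨ solve 3 (λ a b c → (a :+ (b :+ c)) := (b :+ (a :+ c))) refl (term′ (j , false)) (term′ (j , true)) (⨁ (moves is) term′) ⟩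
      term′ (j , true) xor (term′ (j , false) xor ⨁ (moves is) term′) ∎
      where open xor-∧-Solver

  steps-exhausted : ∀ is r g X v → blanks is X < r → steps (moves is) r g X v ≡ false
  steps-exhausted is (suc r) g X v (s≤s b≤r) = trans
    (⨁-congAll (blanks-go-< is X) (λ p lt → trans (∧-congʳ-true (free X p)
      (λ f → steps-exhausted is r g (go X p) _ (≤-trans (lt f) b≤r))) (∧-zeroʳ (free X p))))
    (⨁-false (moves is))

  -- The actual chains behind the terms of `steps`. Consistency, required by `∂-alternating`, is
  -- available only for label sets that come from such a chain. The start `0̂` carries no label.
  data Run (ms : List (Move n)) : ℕ → SignVector n → Labels N → Set where
    start : Run ms 0 0̂ none
    move  : ∀ {r X v} p → Run ms r X v → free X p ≡ true → Run ms (suc r) (go X p) (add (label (go X p)) v)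

  Chain : SignVector n → Labels N → Set
  Chain X v = ∃ λ (Ys : List (SignVector n)) →
    All (λ Y → Nonzero Y × Y ⊑ X) Ys ×
    (∀ {Y Z} → Y ∈ Ys → Z ∈ Ys → Y ⊑ Z ⊎ Z ⊑ Y) ×
    (∀ l → 0 < multiplicity v l → ∃ λ Y → Y ∈ Ys × label Y ≡ l)

  Run-Chain : ∀ {ms r X v} → Run ms r X v → Chain X v
  Run-Chain start = [] , [] , (λ ()) , λ l p → contradiction (≤-reflexive (multiplicity-none l)) (<⇒≱ p)
  Run-Chain (move {X = X} {v} p run f) with Run-Chain run
  ... | Ys , below , comparable , labels = X′ ∷ Ys , (go-Nonzero X p , id) ∷ below′ , comparable′ , labels′
    where
    X′ = go X p
    below′ : All (λ Y → Nonzero Y × Y ⊑ X′) Ys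
    below′ = All.map (λ (nz , Y⊑X) → nz , λ {i} {s} e → go-stays X p f (Y⊑X e)) below
    comparable′ : ∀ {Y Z} → Y ∈ X′ ∷ Ys → Z ∈ X′ ∷ Ys → Y ⊑ Z ⊎ Z ⊑ Y
    comparable′ (here refl) (here refl) = inj₁ id
    comparable′ (here refl) (there Z∈)  = inj₂ (proj₂ (All.lookup below′ Z∈))
    comparable′ (there Y∈)  (here refl) = inj₁ (proj₂ (All.lookup below′ Y∈))
    comparable′ (there Y∈)  (there Z∈)  = comparable Y∈ Z∈
    labels′ : ∀ l → 0 < multiplicity (add (label X′) v) l → ∃ λ Y → Y ∈ X′ ∷ Ys × label Y ≡ l
    labels′ l m with multiplicity-add (label X′) l v m
    ... | inj₁ refl = X′ , here refl , refl
    ... | inj₂ m′   = let (Y , Y∈ , e) = labels l m′ in Y , there Y∈ , e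

  Run-Consistent : ∀ {ms r X v} → Run ms r X v → Consistent v
  Run-Consistent run j (m⁺ , m⁻) with Run-Chain run
  ... | Ys , below , comparable , labels with labels (j , true) m⁺ | labels (j , false) m⁻
  ...   | Y , Y∈ , e | Z , Z∈ , e′ with comparable Y∈ Z∈
  ...     | inj₁ Y⊑Z = no-opposite Y Z (proj₁ (All.lookup below Y∈)) Y⊑Z (trans e′ (cong opposite (sym e)))
  ...     | inj₂ Z⊑Y = no-opposite Z Y (proj₁ (All.lookup below Z∈)) Z⊑Y (trans e (cong opposite (sym e′)))

  Run-total : ∀ {ms r X v} → Run ms r X v → total v ≡ r
  Run-total start           = total-none N
  Run-total (move {X = X} {v} p run f) = trans (total-add (label (go X p)) v) (cong suc (Run-total run))

  steps-cong : ∀ {ms} r {g g′ : Observable} → (∀ {q X v} → Run ms q X v → g X v ≡ g′ X v) →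
    ∀ {q X v} → Run ms q X v → steps ms r g X v ≡ steps ms r g′ X v
  steps-cong      zero    e run         = e run
  steps-cong {ms} (suc r) e {X = X} run = ⨁-cong ms (λ p → ∧-congʳ-true (free X p) (λ f → steps-cong r e (move p run f)))

  steps-witness : ∀ {ms} r {g : Observable} {q X v} → Run ms q X v → steps ms r g X v ≡ true →
    ∃₂ λ X′ v′ → Run ms (r + q) X′ v′ × g X′ v′ ≡ true
  steps-witness      zero    run e = _ , _ , run , e
  steps-witness {ms} (suc r) {q = q} {X} run e with ⨁-witness ms e
  ... | p , e′ with free X p in f
  ...   | true with steps-witness r (move p run f) e′
  ...     | X′ , v′ , run′ , e″ = X′ , v′ , subst (λ r → Run ms r X′ v′) (+-suc r q) run′ , e″

  alternatingChains-odd : ∀ {is} → Unique is → steps (moves is) (length is) (λ _ → alternating true) 0̂ none ≡ true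
  alternatingChains-odd [] = alternating-none N true
  alternatingChains-odd {i ∷ is} (i∉is ∷ uniq) = begin
    steps (moves (i ∷ is)) (suc r) (λ _ → alternating true) 0̂ none
      ≡⟨ steps-split (moves is) (suc r) _ 0̂ none i∉ (lookup-replicate i nothing) ⟩
    steps D (suc r) (λ _ → alternating true) 0̂ none xor
      (steps D⁻ (suc r) (λ _ → alternating true) 0̂ none xor steps (moves is) (suc r) (λ _ → alternating true) 0̂ none)
      -- The lower hemisphere is reflected into the upper one; the equator has too few coordinates
      -- for `suc r` moves.
      ≡⟨ cong (steps D (suc r) (λ _ → alternating true) 0̂ none xor_) (cong₂ _xor_ reflected
           (steps-exhausted is (suc r) _ 0̂ none (s≤s (blanks≤length is 0̂)))) ⟩
    steps D (suc r) (λ _ → alternating true) 0̂ none xor (steps D (suc r) (λ _ → alternating false) 0̂ none xor false)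
      ≡⟨ cong (steps D (suc r) (λ _ → alternating true) 0̂ none xor_) (xor-identityʳ _) ⟩
    steps D (suc r) (λ _ → alternating true) 0̂ none xor steps D (suc r) (λ _ → alternating false) 0̂ none
      ≡⟨ sym (steps-xor D (suc r) _ _ 0̂ none) ⟩
    steps D (suc r) (λ _ v → alternating true v xor alternating false v) 0̂ none
      ≡⟨ steps-cong (suc r) (λ {_} {_} {v} run → sym (∂-alternating true v (Run-Consistent run))) start ⟩
    steps D (suc r) (λ _ → ∂ (alternating true)) 0̂ none
      ≡⟨ steps-∂ D r (λ _ → alternating true) 0̂ none ⟩
    steps D r (unlabelledStep D (λ _ → alternating true)) 0̂ none xor ∂ (steps D (suc r) (λ _ → alternating true) 0̂) none
      -- No label precedes the start, so the boundary term vanishes. The unlabelled last vertex must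
      -- come from a move at `i`, so the labelled part of the chain lies in the equator.
      ≡⟨ cong₂ _xor_ (steps-cong r (λ {_} {X} {v} _ → unlabelledStep-moves i true is (alternating true) X v) start) (∂-none N _) ⟩
    steps D r (vacant i (λ _ → alternating true)) 0̂ none xor false
      ≡⟨ xor-identityʳ _ ⟩
    steps D r (vacant i (λ _ → alternating true)) 0̂ none
      ≡⟨ steps-vacant (moves is) r _ 0̂ none i∉ (lookup-replicate i nothing) ⟩
    steps (moves is) r (λ _ → alternating true) 0̂ none
      ≡⟨ alternatingChains-odd uniq ⟩
    true ∎
    where
    r = length is
    D D⁻ : List (Move n)
    D  = (i , true) ∷ moves is
    D⁻ = (i , false) ∷ moves is
    i∉ : All (λ p → i ≢ proj₁ p) (moves is)
    i∉ = moves-All i∉is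
    reflected : steps D⁻ (suc r) (λ _ → alternating true) 0̂ none ≡ steps D (suc r) (λ _ → alternating false) 0̂ none
    reflected = trans
      (steps-neg i false is (suc r) _ (λ _ → alternating false) (λ _ v → sym (alternating-swapSigns false v)) 0̂ none)
      (cong₂ (steps D (suc r) (λ _ → alternating false)) (neg-0̂ n) (swapSigns-none N))

  -- The chain records n labels, so with `N ≤ n` the alternating set is full.
  fullAlternatingChain : N ≤ n → ∃ λ (Ys : List (SignVector n)) →
    (∀ {Y Z} → Y ∈ Ys → Z ∈ Ys → Y ⊑ Z ⊎ Z ⊑ Y) ×
    (∀ {Y} → Y ∈ Ys → Nonzero Y) ×
    (∀ j → ∃ λ Y → Y ∈ Ys × label Y ≡ (j , flips (toℕ j) true))
  fullAlternatingChain N≤n with steps-witness (length (allFin n)) start (alternatingChains-odd (allFin⁺ n))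
  ... | X , v , run , alt with Run-Chain run
  ...   | Ys , below , comparable , labels =
    Ys , comparable , (λ Y∈ → proj₁ (All.lookup below Y∈)) ,
    λ j → labels _ (alternating-full true v alt (≤-trans N≤n (≤-reflexive (sym total≡n))) j)
    where
    total≡n : total v ≡ n
    total≡n = trans (Run-total run) (trans (+-identityʳ _) (length-tabulate {n = n} id))

-- From a relation to an antipodal labelling

⊑-Nonzero : ∀ (X Y : SignVector n) → X ⊑ Y → Nonzero X → Nonzero Y
⊑-Nonzero (nothing ∷ X) (nothing ∷ Y) X⊑Y nz = ⊑-Nonzero X Y (λ {i} → X⊑Y {suc i}) nz
⊑-Nonzero (nothing ∷ X) (just t ∷ Y)  X⊑Y nz = t , refl
⊑-Nonzero (just s ∷ X)  (y ∷ Y)       X⊑Y nz with refl ← X⊑Y {zero} refl = s , refl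

-- A vector may have several valid labels; exclusivity is required of all of them, so any choice is
-- good. Having `suc N` labels provides a default value for the zero vector.
module RelationalLabelling (V : SignVector n → Label (suc N) → Set)
  (V-total : ∀ X → Nonzero X → ∃ (V X))
  (V-neg : ∀ {X l} → V X l → V (neg X) (opposite l))
  (V-exclusive : ∀ {X Y l} → X ⊑ Y → V X l → ¬ V Y (opposite l)) where

  -- Choosing labels only where the first sign is + makes the labelling antipodal.
  choose : ∀ X f → first X ≡ f → Label (suc N)
  choose X nothing      e = zero , true
  choose X (just true)  e = proj₁ (V-total X (true , e))
  choose X (just false) e = opposite (proj₁ (V-total (neg X) (true , trans (first-neg X) (cong (Maybe.map not) e))))

  label : SignVector n → Label (suc N)
  label X = choose X (first X) refl

  label≡choose : ∀ X {f} (e : first X ≡ f) → label X ≡ choose X f e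
  label≡choose X refl = refl

  label-valid : ∀ X → Nonzero X → V X (label X)
  label-valid X (true  , e) rewrite label≡choose X e = proj₂ (V-total X (true , e))
  label-valid X (false , e) rewrite label≡choose X e =
    subst (λ Y → V Y (opposite (proj₁ w))) (neg-involutive X) (V-neg (proj₂ w))
    where w = V-total (neg X) (true , trans (first-neg X) (cong (Maybe.map not) e))

  -- `V-total` may depend on the proof of nonzeroness, and negation produces different proofs;
  -- uniqueness of identity proofs identifies them.
  total-irrelevant : ∀ {X Y} (p : first X ≡ just true) (q : first Y ≡ just true) → X ≡ Y →
    proj₁ (V-total X (true , p)) ≡ proj₁ (V-total Y (true , q))
  total-irrelevant p q refl = cong (λ r → proj₁ (V-total _ (true , r))) (uip p q)

  label-neg : ∀ X → Nonzero X → label (neg X) ≡ opposite (label X)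
  label-neg X (true , e) = trans
    (label≡choose (neg X) (trans (first-neg X) (cong (Maybe.map not) e)))
    (cong opposite (trans (total-irrelevant _ e (neg-involutive X)) (sym (label≡choose X e))))
  label-neg X (false , e) = trans
    (label≡choose (neg X) (trans (first-neg X) (cong (Maybe.map not) e)))
    (trans (total-irrelevant _ _ refl) (trans (sym (opposite-involutive _)) (cong opposite (sym (label≡choose X e)))))

  no-opposite : ∀ X Y → Nonzero X → X ⊑ Y → label Y ≢ opposite (label X)
  no-opposite X Y nz@(s , e) X⊑Y eq =
    V-exclusive X⊑Y (label-valid X nz) (subst (V Y) eq (label-valid Y (⊑-Nonzero X Y X⊑Y nz)))

  open AntipodalLabelling label label-neg no-opposite using (fullAlternatingChain)

  kyFan : suc N ≤ n → ∃ λ (Ys : List (SignVector n)) →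
    (∀ {Y Z} → Y ∈ Ys → Z ∈ Ys → Y ⊑ Z ⊎ Z ⊑ Y) × (∀ j → ∃ λ Y → Y ∈ Ys × V Y (j , flips (toℕ j) true))
  kyFan N≤n with fullAlternatingChain N≤n
  ... | Ys , comparable , nonzero , labels = Ys , comparable , λ j →
    let Y , Y∈ , e = labels j in Y , Y∈ , subst (V Y) e (label-valid Y (nonzero Y∈))

-- Sign arithmetic and the two sides of a sign vector

flips-+ : ∀ a b s → flips (a + b) s ≡ flips a (flips b s)
flips-+ zero    b s = refl
flips-+ (suc a) b s = cong not (flips-+ a b s)

flips-involutive : ∀ d s → flips d (flips d s) ≡ s
flips-involutive zero    s = refl
flips-involutive (suc d) s =
  trans (cong not (flips-not d (flips d s))) (trans (not-involutive _) (flips-involutive d s))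

onSide : Bool → Maybe Bool → Bool
onSide s nothing  = false
onSide s (just t) = if s then t else not t

side : Bool → SignVector n → Subset n
side s = map (onSide s)

onSide-just : ∀ s x → onSide s x ≡ true → x ≡ just s
onSide-just true  (just true)  e = refl
onSide-just false (just false) e = refl

onSide-true : ∀ s → onSide s (just s) ≡ true
onSide-true true  = refl
onSide-true false = refl

side-neg : ∀ s (X : SignVector n) → side s (neg X) ≡ side (not s) X
side-neg s     []               = refl
side-neg true  (nothing ∷ X)    = cong (_ ∷_) (side-neg true X)
side-neg false (nothing ∷ X)    = cong (_ ∷_) (side-neg false X)
side-neg true  (just t ∷ X)     = cong (_ ∷_) (side-neg true X)
side-neg false (just true ∷ X)  = cong (_ ∷_) (side-neg false X)
side-neg false (just false ∷ X) = cong (_ ∷_) (side-neg false X)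

side-not-neg : ∀ s (X : SignVector n) → side (not s) (neg X) ≡ side s X
side-not-neg s X = trans (side-neg (not s) X) (cong (λ s → side s X) (not-involutive s))

∈side⇒just : ∀ s (X : SignVector n) {i} → i ∈S side s X → lookup X i ≡ just s
∈side⇒just s X {i} i∈ = onSide-just s _ (trans (sym (lookup-map i (onSide s) X)) ([]=⇒lookup i∈))

just⇒∈side : ∀ s (X : SignVector n) {i} → lookup X i ≡ just s → i ∈S side s X
just⇒∈side s X {i} e = lookup⇒[]= i _ (trans (lookup-map i (onSide s) X) (trans (cong (onSide s) e) (onSide-true s)))

side-mono : ∀ s (X Y : SignVector n) → X ⊑ Y → side s X ⊆ side s Y
side-mono s X Y X⊑Y i∈ = just⇒∈side s Y (X⊑Y (∈side⇒just s X i∈))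

sides-disjoint : ∀ s (X : SignVector n) {A B} → A ⊆ side s X → B ⊆ side (not s) X → A ∩ B ≡ ∅
sides-disjoint s X {A} {B} A⊆ B⊆ = Empty-unique λ (i , i∈) →
  let i∈A , i∈B = x∈p∩q⁻ A B i∈ in
  impossible s (trans (sym (∈side⇒just s X (A⊆ i∈A))) (∈side⇒just (not s) X (B⊆ i∈B)))
  where
  impossible : ∀ s → just s ≢ just (not s)
  impossible true  ()
  impossible false ()

sides-injective : ∀ {X Y : SignVector n} → side true X ≡ side true Y → side false X ≡ side false Y → X ≡ Y
sides-injective {X = []}    {[]}    _ _ = refl
sides-injective {X = x ∷ X} {y ∷ Y} p q =
  cong₂ _∷_ (head x y (∷-injectiveˡ p) (∷-injectiveˡ q)) (sides-injective (∷-injectiveʳ p) (∷-injectiveʳ q))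
  where
  head : ∀ x y → onSide true x ≡ onSide true y → onSide false x ≡ onSide false y → x ≡ y
  head nothing      nothing      _  _ = refl
  head nothing      (just false) _  ()
  head (just false) nothing      _  ()
  head (just s)     (just .s)    refl _ = refl

⊆∧∣∣≥⇒≡ : ∀ {p q : Subset n} → p ⊆ q → ∣ q ∣ ≤ ∣ p ∣ → p ≡ q
⊆∧∣∣≥⇒≡ {p = []}          {[]}          p⊆q le = refl
⊆∧∣∣≥⇒≡ {p = outside ∷ p} {outside ∷ q} p⊆q le = cong (outside ∷_) (⊆∧∣∣≥⇒≡ (drop-∷-⊆ p⊆q) le)
⊆∧∣∣≥⇒≡ {p = outside ∷ p} {inside  ∷ q} p⊆q le =
  contradiction (p⊆q⇒∣p∣≤∣q∣ (drop-∷-⊆ p⊆q)) (<⇒≱ le)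
⊆∧∣∣≥⇒≡ {p = inside  ∷ p} {outside ∷ q} p⊆q le with () ← p⊆q here
⊆∧∣∣≥⇒≡ {p = inside  ∷ p} {inside  ∷ q} p⊆q le = cong (inside ∷_) (⊆∧∣∣≥⇒≡ (drop-∷-⊆ p⊆q) (s≤s⁻¹ le))

size : SignVector n → ℕ
size X = ∣ side true X ∣ + ∣ side false X ∣

size-neg : ∀ (X : SignVector n) → size (neg X) ≡ size X
size-neg X = trans (cong₂ (λ P Q → ∣ P ∣ + ∣ Q ∣) (side-neg true X) (side-neg false X)) (+-comm ∣ side false X ∣ _)

size-Nonzero : ∀ (X : SignVector n) → Nonzero X → 0 < size X
size-Nonzero (nothing ∷ X)    nz = size-Nonzero X nz
size-Nonzero (just true ∷ X)  nz = s≤s z≤n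
size-Nonzero (just false ∷ X) nz = ≤-trans (s≤s z≤n) (≤-reflexive (sym (+-suc _ _)))

-- Neither side shrinks from X to Y, so the bound on the sum of sizes bounds each side separately.
⊑∧size≥⇒≡ : ∀ (X Y : SignVector n) → X ⊑ Y → size Y ≤ size X → X ≡ Y
⊑∧size≥⇒≡ X Y X⊑Y le = sides-injective
  (⊆∧∣∣≥⇒≡ P⊆ (+-cancelʳ-≤ _ _ _ (≤-trans le (+-monoʳ-≤ ∣ side true X ∣ (p⊆q⇒∣p∣≤∣q∣ Q⊆)))))
  (⊆∧∣∣≥⇒≡ Q⊆ (+-cancelˡ-≤ _ _ _ (≤-trans le (+-monoˡ-≤ ∣ side false X ∣ (p⊆q⇒∣p∣≤∣q∣ P⊆)))))
  where
  P⊆ = side-mono true X Y X⊑Y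
  Q⊆ = side-mono false X Y X⊑Y

-- Subsets of prescribed size and colour pairs

subsetOfSize : ∀ (P : Subset n) k → k ≤ ∣ P ∣ → ∃ λ A → A ⊆ P × ∣ A ∣ ≡ k
subsetOfSize []            zero    _  = [] , ⊆-refl , refl
subsetOfSize (outside ∷ P) k       le = let A , A⊆ , e = subsetOfSize P k le in outside ∷ A , out⊆ A⊆ , e
subsetOfSize (inside ∷ P)  zero    le = let A , A⊆ , e = subsetOfSize P zero z≤n in outside ∷ A , out⊆ A⊆ , e
subsetOfSize (inside ∷ P)  (suc k) le =
  let A , A⊆ , e = subsetOfSize P k (s≤s⁻¹ le) in inside ∷ A , in⊆in A⊆ , cong suc e

-- If the first element lies in P and k > 0, one subset avoids it and the recursion supplies k
-- subsets containing it.
distinctSubsets : ∀ (P : Subset n) k → k < ∣ P ∣ → ∃ λ (F : Fin (suc k) → Subset n) →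
  (∀ i j → F i ≡ F j → i ≡ j) × (∀ i → F i ⊆ P × ∣ F i ∣ ≡ k)
distinctSubsets (outside ∷ P) k le =
  let F , inj , sub = distinctSubsets P k le in
  (λ i → outside ∷ F i) , (λ i j e → inj i j (∷-injectiveʳ e)) , λ i → out⊆ (proj₁ (sub i)) , proj₂ (sub i)
distinctSubsets (inside ∷ P) zero le =
  let A , A⊆ , e = subsetOfSize P zero z≤n in
  (λ _ → outside ∷ A) , (λ { zero zero _ → refl }) , λ _ → out⊆ A⊆ , e
distinctSubsets {n = suc n} (inside ∷ P) (suc k) le = F , F-injective , F-sub
  where
  A = subsetOfSize P (suc k) (s≤s⁻¹ le)
  G = distinctSubsets P k (s≤s⁻¹ le)
  F : Fin (suc (suc k)) → Subset (suc n)
  F zero    = outside ∷ proj₁ A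
  F (suc i) = inside ∷ proj₁ G i
  F-injective : ∀ i j → F i ≡ F j → i ≡ j
  F-injective zero    zero    e = refl
  F-injective (suc i) (suc j) e = cong suc (proj₁ (proj₂ G) i j (∷-injectiveʳ e))
  F-sub : ∀ i → F i ⊆ inside ∷ P × ∣ F i ∣ ≡ suc k
  F-sub zero    = out⊆ (proj₁ (proj₂ A)) , proj₂ (proj₂ A)
  F-sub (suc i) = let sub , e = proj₂ (proj₂ G) i in in⊆in sub , cong suc e

⌊/2⌋-cases : ∀ x → x ≡ ⌊ x /2⌋ + ⌊ x /2⌋ ⊎ x ≡ suc (⌊ x /2⌋ + ⌊ x /2⌋)
⌊/2⌋-cases zero          = inj₁ refl
⌊/2⌋-cases (suc zero)    = inj₂ refl
⌊/2⌋-cases (suc (suc x)) rewrite +-suc ⌊ x /2⌋ ⌊ x /2⌋ =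
  Sum.map (cong (2 +_)) (cong (2 +_)) (⌊/2⌋-cases x)

-- The colouring with 2m + 2 colours

disjoint⇒∣∣+∣∣≤n : (A B : Subset n) → A ∩ B ≡ ∅ → ∣ A ∣ + ∣ B ∣ ≤ n
disjoint⇒∣∣+∣∣≤n []            []            e = z≤n
disjoint⇒∣∣+∣∣≤n (inside  ∷ A) (outside ∷ B) e = s≤s (disjoint⇒∣∣+∣∣≤n A B (∷-injectiveʳ e))
disjoint⇒∣∣+∣∣≤n (outside ∷ A) (inside  ∷ B) e =
  ≤-trans (≤-reflexive (+-suc ∣ A ∣ ∣ B ∣)) (s≤s (disjoint⇒∣∣+∣∣≤n A B (∷-injectiveʳ e)))
disjoint⇒∣∣+∣∣≤n (outside ∷ A) (outside ∷ B) e = m≤n⇒m≤1+n (disjoint⇒∣∣+∣∣≤n A B (∷-injectiveʳ e))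

disjoint⇒≡∁ : (A B : Subset n) → A ∩ B ≡ ∅ → ∣ A ∣ + ∣ B ∣ ≡ n → B ≡ ∁ A
disjoint⇒≡∁ []            []            e s = refl
disjoint⇒≡∁ (inside  ∷ A) (outside ∷ B) e s = cong (outside ∷_) (disjoint⇒≡∁ A B (∷-injectiveʳ e) (suc-injective s))
disjoint⇒≡∁ (outside ∷ A) (inside  ∷ B) e s =
  cong (inside ∷_) (disjoint⇒≡∁ A B (∷-injectiveʳ e) (suc-injective (trans (sym (+-suc ∣ A ∣ ∣ B ∣)) s)))
disjoint⇒≡∁ (outside ∷ A) (outside ∷ B) e s =
  contradiction (disjoint⇒∣∣+∣∣≤n A B (∷-injectiveʳ e)) (<⇒≱ (≤-reflexive (sym s)))

KVertex-≡ : ∀ {k} {A B : KVertex n k} → proj₁ A ≡ proj₁ B → A ≡ B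
KVertex-≡ {A = A , p} {B , q} refl = cong (A ,_) (≡-irrelevant p q)

module Colouring (k : ℕ) where

  -- The sets with minimum i < m get colour 2i + 1. The others lie in the last 2k elements,
  -- where they form a matching, and get colours 2m + 1 and 2m + 2.
  colour : ∀ m → Subset (m + 2 * suc k) → ℕ
  colour zero    (inside  ∷ A) = 1
  colour zero    (outside ∷ A) = 2
  colour (suc m) (inside  ∷ A) = 1
  colour (suc m) (outside ∷ A) = 2 + colour m A

  colour≥1 : ∀ m A → 1 ≤ colour m A
  colour≥1 zero    (inside  ∷ A) = s≤s z≤n
  colour≥1 zero    (outside ∷ A) = s≤s z≤n
  colour≥1 (suc m) (inside  ∷ A) = s≤s z≤n
  colour≥1 (suc m) (outside ∷ A) = s≤s z≤n

  colour≤ : ∀ m A → colour m A ≤ 2 + (m + m)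
  colour≤ zero    (inside  ∷ A) = s≤s z≤n
  colour≤ zero    (outside ∷ A) = s≤s (s≤s z≤n)
  colour≤ (suc m) (inside  ∷ A) = s≤s z≤n
  colour≤ (suc m) (outside ∷ A) =
    s≤s (s≤s (≤-trans (colour≤ m A) (≤-reflexive (cong suc (sym (+-suc m m))))))

  matched : {A B : Subset (2 * suc k)} → ∣ A ∣ ≡ suc k → ∣ B ∣ ≡ suc k → A ∩ B ≡ ∅ → B ≡ ∁ A
  matched {A} {B} a b e = disjoint⇒≡∁ A B e (trans (cong₂ _+_ a b) (cong (suc k +_) (sym (+-identityʳ (suc k)))))

  colour-proper : ∀ m A B → ∣ A ∣ ≡ suc k → ∣ B ∣ ≡ suc k → A ∩ B ≡ ∅ → colour m A ≢ colour m B
  colour-proper zero    A             B             a b e with matched a b e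
  colour-proper zero    (inside  ∷ A) _             a b e | refl = λ ()
  colour-proper zero    (outside ∷ A) _             a b e | refl = λ ()
  colour-proper (suc m) (inside  ∷ A) (outside ∷ B) a b e = λ ()
  colour-proper (suc m) (outside ∷ A) (inside  ∷ B) a b e = λ ()
  colour-proper (suc m) (outside ∷ A) (outside ∷ B) a b e =
    λ eq → colour-proper m A B a b (∷-injectiveʳ e) (suc-injective (suc-injective eq))

  -- Sets containing the first element get colour 1 and the others at least 3, as long as `m` is
  -- positive. Consecutive colours are therefore adjacent only within the final matching, where B
  -- has a single neighbour.
  colour-star : ∀ m A B C → ∣ A ∣ ≡ suc k → ∣ B ∣ ≡ suc k → ∣ C ∣ ≡ suc k → A ∩ B ≡ ∅ → B ∩ C ≡ ∅ →
    colour m A ≡ colour m C → (colour m B ≡ suc (colour m A) ⊎ colour m A ≡ suc (colour m B)) → A ≡ C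
  colour-star zero A B C a b c AB BC _ _ = trans (matched b a (trans (∩-comm B A) AB)) (sym (matched b c BC))
  colour-star (suc m) (inside ∷ A) (outside ∷ B) (inside ∷ C) a b c AB BC _ (inj₁ e) =
    contradiction (colour≥1 m B) (<⇒≱ (≤-reflexive (cong suc (suc-injective (suc-injective e)))))
  colour-star (suc m) (outside ∷ A) (inside ∷ B) (outside ∷ C) a b c AB BC _ (inj₂ e) =
    contradiction (colour≥1 m A) (<⇒≱ (≤-reflexive (cong suc (suc-injective (suc-injective e)))))
  colour-star (suc m) (outside ∷ A) (outside ∷ B) (outside ∷ C) a b c AB BC e₁ e₂ = cong (outside ∷_)
    (colour-star m A B C a b c (∷-injectiveʳ AB) (∷-injectiveʳ BC) (cong (_∸ 2) e₁)
      (Sum.map (cong (_∸ 2)) (cong (_∸ 2)) e₂))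

ColorsAre⇒≡ : ∀ {a b d i} → a ≢ b → b ≢ d → ColorsAre a b d i → a ≡ d × (b ≡ suc a ⊎ a ≡ suc b)
ColorsAre⇒≡ a≢b b≢d ((inj₁ refl , inj₁ refl , _) , _) = contradiction refl a≢b
ColorsAre⇒≡ a≢b b≢d ((inj₂ refl , inj₂ refl , _) , _) = contradiction refl a≢b
ColorsAre⇒≡ a≢b b≢d ((_ , inj₁ refl , inj₁ refl) , _) = contradiction refl b≢d
ColorsAre⇒≡ a≢b b≢d ((_ , inj₂ refl , inj₂ refl) , _) = contradiction refl b≢d
ColorsAre⇒≡ a≢b b≢d ((inj₁ refl , inj₂ refl , inj₁ refl) , _) = refl , inj₁ refl
ColorsAre⇒≡ a≢b b≢d ((inj₂ refl , inj₁ refl , inj₂ refl) , _) = refl , inj₂ refl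

starFreeColoring : ∀ m k → HasStarFreeColoring (m + 2 * suc k) (suc k) (2 + (m + m))
starFreeColoring m k = ((λ (A , _) → colour m A) , λ (A , _) → colour≥1 m A , colour≤ m A) , proper ,
  λ { (A , a) (B , b) (C , c) _ _ A≢C AB BC i colors →
      let e₁ , e₂ = ColorsAre⇒≡ (colour-proper m A B a b AB) (colour-proper m B C b c BC) colors
      in A≢C (KVertex-≡ (colour-star m A B C a b c AB BC e₁ e₂)) }
  where
  open Colouring k
  proper : Proper {m + 2 * suc k} {suc k} (λ (A , _) → colour m A)
  proper (A , a) (B , b) AB = colour-proper m A B a b AB

-- The labelling induced by a star-free colouring

-- The paper's k is suc k.
module LowerBound (n k m : ℕ) (m≤k : m ≤ k)
  (N≤n : suc (k + k + suc m) ≤ n)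
  (c : KVertex n (suc k) → ℕ)
  (c-range : ∀ A → 1 ≤ c A × c A ≤ suc (m + m))
  (starFree : StarFree c) where

  Vertex : Set
  Vertex = KVertex n (suc k)

  c-proper : ∀ A B → KAdj A B → c A ≢ c B
  c-proper = proj₁ starFree

  KAdj-sym : ∀ (A B : Vertex) → KAdj A B → KAdj B A
  KAdj-sym (A , _) (B , _) e = trans (∩-comm B A) e

  class : Vertex → ℕ
  class A = ⌊ pred (c A) /2⌋

  c-cases : ∀ A {j} → class A ≡ j → c A ≡ suc (j + j) ⊎ c A ≡ suc (suc (j + j))
  c-cases A refl with c A | proj₁ (c-range A)
  ... | suc x | _ = Sum.map (cong suc) (cong suc) (⌊/2⌋-cases x)

  class≤m : ∀ A → class A ≤ m
  class≤m A = ≤-trans (⌊n/2⌋-mono (pred-mono-≤ {c A} {suc (m + m)} (proj₂ (c-range A)))) (≤-reflexive (sym (n≡⌊n+n/2⌋ m)))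

  -- Properness makes adjacent vertices distinct, and it makes A and B use both of the colours `i`
  -- and `suc i`.
  no-star : ∀ A B C i → A ≢ C → KAdj A B → KAdj B C →
    c A ≡ i ⊎ c A ≡ suc i → c B ≡ i ⊎ c B ≡ suc i → c C ≡ i ⊎ c C ≡ suc i → ⊥
  no-star A B C i A≢C AB BC a b d = proj₂ starFree A B C
    (λ { refl → c-proper A A AB refl }) (λ { refl → c-proper B B BC refl }) A≢C AB BC i ((a , b , d) , both a b)
    where
    both : c A ≡ i ⊎ c A ≡ suc i → c B ≡ i ⊎ c B ≡ suc i →
      (c A ≡ i ⊎ c B ≡ i ⊎ c C ≡ i) × (c A ≡ suc i ⊎ c B ≡ suc i ⊎ c C ≡ suc i)
    both (inj₁ a) (inj₁ b) = contradiction (trans a (sym b)) (c-proper A B AB)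
    both (inj₁ a) (inj₂ b) = inj₁ a , inj₂ (inj₁ b)
    both (inj₂ a) (inj₁ b) = inj₂ (inj₁ b) , inj₁ a
    both (inj₂ a) (inj₂ b) = contradiction (trans a (sym b)) (c-proper A B AB)

  -- Classes inside a side, and the label relation

  Member : ℕ → Subset n → Set
  Member j P = Σ Vertex λ A → proj₁ A ⊆ P × class A ≡ j

  Heavy : ℕ → Subset n → Set
  Heavy j P = ∃₂ λ A B → A ≢ B × (proj₁ A ⊆ P × class A ≡ j) × (proj₁ B ⊆ P × class B ≡ j)

  heavy-exclusive : ∀ {j s X} → Heavy j (side s X) → ¬ Member j (side (not s) X)
  heavy-exclusive {j} {s} {X} (A , B , A≢B , (A⊆ , eA) , (B⊆ , eB)) (C , C⊆ , eC) = no-star A C B (suc (j + j)) A≢B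
    (sides-disjoint s X A⊆ C⊆) (KAdj-sym B C (sides-disjoint s X B⊆ C⊆)) (c-cases A eA) (c-cases C eC) (c-cases B eB)

  -- P has at least k+2 subsets of size k+1, and there are only m+1 ≤ k+1 classes.
  large⇒heavy : ∀ P → suc k < ∣ P ∣ → ∃ λ j → j ≤ m × Heavy j P
  large⇒heavy P le with distinctSubsets P (suc k) le
  ... | F , inj , sub with pigeonhole (s≤s (s≤s m≤k)) (λ i → fromℕ< (s≤s (class≤m (F i , proj₂ (sub i)))))
  ...   | i , j , i<j , e = class A , class≤m A , A , B , (λ eq → Fin-<⇒≢ i<j (inj i j (cong proj₁ eq))) ,
        (proj₁ (sub i) , refl) , (proj₁ (sub j) , sym (fromℕ<-injective _ _ _ _ e))
    where
    A B : Vertex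
    A = F i , proj₂ (sub i)
    B = F j , proj₂ (sub j)

  -- The size bound means that the member fills its side.
  Light : ℕ → Bool → SignVector n → Set
  Light j s X = ∣ side s X ∣ ≤ suc k × Member j (side s X) × ¬ Member j (side (not s) X)

  ClassLabel : ℕ → Bool → SignVector n → Set
  ClassLabel j s X = Heavy j (side s X) ⊎ Light j s X

  SmallLabel : ℕ → Bool → SignVector n → Set
  SmallLabel l s X = suc l ≡ size X × first X ≡ just s

  -- The sign is chosen so that in an alternating chain class d+1, where d is the class of
  -- A and B, gets the sign t of the side with the smaller colour.
  PairLabel : Bool → SignVector n → Set
  PairLabel s X = ∃ λ t → ∃₂ λ (A B : Vertex) →
    side t X ≡ proj₁ A × side (not t) X ≡ proj₁ B × c A < c B × class A ≡ class B × s ≡ flips (class A) t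

  -- Sizes 1 to `k + k` take the first `k + k` indices, then come the pair label and the `suc m`
  -- classes. This order fixes how the sign of the pair label relates to the signs of the classes in
  -- an alternating chain.
  data _HasLabel_ (X : SignVector n) : Label (suc (k + k + suc m)) → Set where
    small : ∀ {l s} → toℕ l < k + k → SmallLabel (toℕ l) s X → X HasLabel (l , s)
    pair  : ∀ {l s} → toℕ l ≡ k + k → PairLabel s X → X HasLabel (l , s)
    ofClass : ∀ {l s} j → toℕ l ≡ suc (k + k) + j → ClassLabel j s X → X HasLabel (l , s)

  ClassLabel⇒Member : ∀ {j s X} → ClassLabel j s X → Member j (side s X)
  ClassLabel⇒Member (inj₁ (A , _ , _ , a , _)) = A , a
  ClassLabel⇒Member (inj₂ (_ , a , _))         = a

  ClassLabel⇒¬Member : ∀ {j s X} → ClassLabel j s X → ¬ Member j (side (not s) X)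
  ClassLabel⇒¬Member {X = X} (inj₁ heavy) = heavy-exclusive {X = X} heavy
  ClassLabel⇒¬Member (inj₂ (_ , _ , ¬b)) = ¬b

  PairLabel-side : ∀ {s X} → PairLabel s X → ∀ t → ∣ side t X ∣ ≡ suc k
  PairLabel-side (true  , A , B , a , b , _) true  = trans (cong ∣_∣ a) (proj₂ A)
  PairLabel-side (true  , A , B , a , b , _) false = trans (cong ∣_∣ b) (proj₂ B)
  PairLabel-side (false , A , B , a , b , _) true  = trans (cong ∣_∣ b) (proj₂ B)
  PairLabel-side (false , A , B , a , b , _) false = trans (cong ∣_∣ a) (proj₂ A)

  PairLabel-size : ∀ {s X} → PairLabel s X → size X ≡ suc k + suc k
  PairLabel-size {X = X} p = cong₂ _+_ (PairLabel-side {X = X} p true) (PairLabel-side {X = X} p false)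

  -- The sides determine A and B up to exchange, and an exchange would reverse `c A < c B`.
  PairLabel-unique : ∀ {s s′ X} → PairLabel s X → PairLabel s′ X → s ≡ s′
  PairLabel-unique {X = X} (t , A , B , a , b , A<B , _ , e) (t′ , A′ , B′ , a′ , b′ , A<B′ , _ , e′) with t ≟B t′
  ... | yes refl = trans e (trans (cong (λ D → flips (class D) t) (KVertex-≡ (trans (sym a) a′))) (sym e′))
  ... | no  t≢t′ with refl ← ¬-not (t≢t′ ∘ sym) = contradiction A<B (<⇒≯
      (subst₂ _<_ (cong c A′≡B) (cong c B′≡A) A<B′))
    where
    A′≡B : A′ ≡ B
    A′≡B = KVertex-≡ (trans (sym a′) b)
    B′≡A : B′ ≡ A
    B′≡A = KVertex-≡ (trans (sym b′) (trans (cong (λ s → side s X) (not-involutive t)) a))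

  HasLabel-neg : ∀ {X l} → X HasLabel l → neg X HasLabel opposite l
  HasLabel-neg {X} (small {s = s} lt (e , f)) =
    small lt (trans e (sym (size-neg X)) , trans (first-neg X) (cong (Maybe.map not) f))
  HasLabel-neg {X} (pair eq (t , A , B , a , b , lt , e , refl)) =
    pair eq (not t , A , B , trans (side-not-neg t X) a , trans (side-not-neg (not t) X) b , lt , e ,
      sym (flips-not (class A) t))
  HasLabel-neg {X} (ofClass {s = s} j eq cl) = ofClass j eq (flip cl)
    where
    flip : ClassLabel j s X → ClassLabel j (not s) (neg X)
    flip (inj₁ heavy) = inj₁ (subst (Heavy j) (sym (side-not-neg s X)) heavy)
    flip (inj₂ (le , a , ¬b)) = inj₂
      ( subst (λ P → ∣ P ∣ ≤ suc k) (sym (side-not-neg s X)) le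
      , subst (Member j) (sym (side-not-neg s X)) a
      , λ b → ¬b (subst (Member j) (side-not-neg (not s) X) b))

  -- For size and pair labels, equal sizes force X = Y, where the sign is unique. For class labels,
  -- the member found at X persists in Y, whose opposite label forbids it.
  HasLabel-exclusive : ∀ {X Y l} → X ⊑ Y → X HasLabel l → ¬ Y HasLabel opposite l
  HasLabel-exclusive {X} {Y} X⊑Y (small _ (e , f)) (small _ (e′ , f′))
    with refl ← ⊑∧size≥⇒≡ X Y X⊑Y (≤-reflexive (trans (sym e′) e)) = just≢just-not (trans (sym f) f′)
    where
    just≢just-not : ∀ {s} → just s ≢ just (not s)
    just≢just-not {true}  ()
    just≢just-not {false} ()
  HasLabel-exclusive X⊑Y (small lt _) (pair eq _)        = <-irrefl eq lt
  HasLabel-exclusive X⊑Y (small lt _) (ofClass j eq _)   = <⇒≱ lt (≤-trans (m≤n⇒m≤1+n (m≤m+n _ j)) (≤-reflexive (sym eq)))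
  HasLabel-exclusive X⊑Y (pair eq _)  (small lt _)       = <-irrefl eq lt
  HasLabel-exclusive {X} {Y} {l , s} X⊑Y (pair eq p) (pair _ q)
    with refl ← ⊑∧size≥⇒≡ X Y X⊑Y (≤-reflexive (trans (PairLabel-size {X = Y} q) (sym (PairLabel-size {X = X} p)))) =
    not-¬ {s} refl (PairLabel-unique {X = X} p q)
  HasLabel-exclusive X⊑Y (pair eq _)  (ofClass j eq′ _)  =
    <⇒≱ (m≤m+n (suc (k + k)) j) (≤-reflexive (trans (sym eq′) eq))
  HasLabel-exclusive X⊑Y (ofClass j eq _) (small lt _)   = <⇒≱ lt (≤-trans (m≤n⇒m≤1+n (m≤m+n _ j)) (≤-reflexive (sym eq)))
  HasLabel-exclusive X⊑Y (ofClass j eq _) (pair eq′ _)   =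
    <⇒≱ (m≤m+n (suc (k + k)) j) (≤-reflexive (trans (sym eq) eq′))
  HasLabel-exclusive {X} {Y} {l , s} X⊑Y (ofClass j eq x) (ofClass j′ eq′ y)
    with refl ← +-cancelˡ-≡ (suc (k + k)) j j′ (trans (sym eq) eq′) with ClassLabel⇒Member {X = X} x
  ... | A , A⊆ , e = ClassLabel⇒¬Member {X = Y} y
    (A , ⊆-trans (⊆-trans A⊆ (side-mono s X Y X⊑Y)) (⊆-reflexive (cong (λ s → side s Y) (sym (not-involutive s)))) , e)

  index-bound : ∀ {j} → j ≤ m → suc (k + k) + j < suc (k + k + suc m)
  index-bound j≤m = s≤s (≤-trans (s≤s (+-monoʳ-≤ (k + k) j≤m)) (≤-reflexive (sym (+-suc (k + k) m))))

  index : ∀ j → j ≤ m → Fin (suc (k + k + suc m))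
  index j j≤m = fromℕ< (index-bound j≤m)

  toℕ-index : ∀ j j≤m → toℕ (index j j≤m) ≡ suc (k + k) + j
  toℕ-index j j≤m = toℕ-fromℕ< (index-bound j≤m)

  small-index : ∀ {l} → l ≤ k + k → Fin (suc (k + k + suc m))
  small-index l≤ = fromℕ< (s≤s (≤-trans l≤ (m≤m+n (k + k) (suc m))))

  no-member : ∀ {j P} → ∣ P ∣ ≤ k → ¬ Member j P
  no-member le (A , A⊆ , _) = <⇒≱ (s≤s le) (≤-trans (≤-reflexive (sym (proj₂ A))) (p⊆q⇒∣p∣≤∣q∣ A⊆))

  HasLabel-light : ∀ s X (e : ∣ side s X ∣ ≡ suc k) →
    ¬ Member (class (side s X , e)) (side (not s) X) → ∃ (X HasLabel_)
  HasLabel-light s X e ¬b = (index _ (class≤m A) , s) , ofClass _ (toℕ-index _ (class≤m A))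
    (inj₂ (≤-reflexive e , (A , ⊆-refl , refl) , ¬b))
    where
    A : Vertex
    A = side s X , e

  HasLabel-heavy : ∀ s X → suc k < ∣ side s X ∣ → ∃ (X HasLabel_)
  HasLabel-heavy s X lt with large⇒heavy (side s X) lt
  ... | j , j≤m , heavy = (index j j≤m , s) , ofClass j (toℕ-index j j≤m) (inj₁ heavy)

  HasLabel-pair : ∀ t X (A B : Vertex) → side t X ≡ proj₁ A → side (not t) X ≡ proj₁ B → c A < c B → class A ≡ class B →
    ∃ (X HasLabel_)
  HasLabel-pair t X A B a b lt e =
    (small-index ≤-refl , flips (class A) t) , pair (toℕ-fromℕ< _) (t , A , B , a , b , lt , e , refl)

  HasLabel-both : ∀ X → ∣ side true X ∣ ≡ suc k → ∣ side false X ∣ ≡ suc k → ∃ (X HasLabel_)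
  HasLabel-both X p q = compare (class A ≟ class B)
    where
    A B : Vertex
    A = side true X , p
    B = side false X , q
    compare : Dec (class A ≡ class B) → ∃ (X HasLabel_)
    compare (yes e) with <-cmp (c A) (c B)
    ... | tri< lt _ _ = HasLabel-pair true X A B refl refl lt e
    ... | tri≈ _ eq _ = contradiction eq (c-proper A B (sides-disjoint true X ⊆-refl ⊆-refl))
    ... | tri> _ _ gt = HasLabel-pair false X B A refl refl gt (sym e)
    -- The only vertex inside the false side is B, which is of another class.
    compare (no ¬e) = HasLabel-light true X p λ { (C , C⊆ , e) → ¬e (trans (sym e) (cong class
      (KVertex-≡ {A = C} {B} (⊆∧∣∣≥⇒≡ C⊆ (≤-reflexive (trans q (sym (proj₂ C)))))))) }

  HasLabel-small : ∀ X → Nonzero X → ∣ side true X ∣ ≤ k → ∣ side false X ∣ ≤ k → ∃ (X HasLabel_)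
  HasLabel-small X nz@(s , f) p q with size X in e | size-Nonzero X nz | +-mono-≤ p q
  ... | suc l | _ | l< =
    (small-index (<⇒≤ l<) , s) , small (subst (_< k + k) (sym (toℕ-fromℕ< _)) l<) (trans (cong suc (toℕ-fromℕ< _)) (sym e) , f)

  HasLabel-total : ∀ X → Nonzero X → ∃ (X HasLabel_)
  HasLabel-total X nz with <-cmp (suc k) ∣ side true X ∣ | <-cmp (suc k) ∣ side false X ∣
  ... | tri< lt _ _ | _ = HasLabel-heavy true X lt
  ... | _ | tri< lt _ _ = HasLabel-heavy false X lt
  ... | tri≈ _ p _ | tri≈ _ q _ = HasLabel-both X (sym p) (sym q)
  ... | tri≈ _ p _ | tri> _ _ q = HasLabel-light true X (sym p) (no-member (s≤s⁻¹ q))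
  ... | tri> _ _ p | tri≈ _ q _ = HasLabel-light false X (sym q) (no-member (s≤s⁻¹ p))
  ... | tri> _ _ p | tri> _ _ q = HasLabel-small X nz (s≤s⁻¹ p) (s≤s⁻¹ q)

  open RelationalLabelling _HasLabel_ HasLabel-total HasLabel-neg HasLabel-exclusive

  -- Climbing through the classes of an alternating chain

  module _ (Ys : List (SignVector n)) (comparable : ∀ {Y Z} → Y ∈ Ys → Z ∈ Ys → Y ⊑ Z ⊎ Z ⊑ Y)
    (classes : ∀ j → j ≤ m → ∃ λ Y → Y ∈ Ys × ClassLabel j (flips (suc (k + k) + j) true) Y)
    {Y₀} (Y₀∈ : Y₀ ∈ Ys) {t} {A B : Vertex} (a : side t Y₀ ≡ proj₁ A) (b : side (not t) Y₀ ≡ proj₁ B)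
    (A<B : c A < c B) (A~B : class A ≡ class B) (sign : flips (k + k) true ≡ flips (class A) t) where

    d = class A

    Y₀-class : ∀ s (E : Vertex) → proj₁ E ⊆ side s Y₀ → class E ≡ d
    Y₀-class s E E⊆ with s ≟B t
    ... | yes refl = cong class (KVertex-≡ {A = E} {A}
            (⊆∧∣∣≥⇒≡ (subst (proj₁ E ⊆_) a E⊆) (≤-reflexive (trans (proj₂ A) (sym (proj₂ E))))))
    ... | no  s≢t with refl ← ¬-not s≢t = trans (cong class (KVertex-≡ {A = E} {B}
            (⊆∧∣∣≥⇒≡ (subst (proj₁ E ⊆_) b E⊆) (≤-reflexive (trans (proj₂ B) (sym (proj₂ E))))))) (sym A~B)

    -- The member of a light class would lie in a side of `Y₀`: by inclusion if Y is below `Y₀`, and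
    -- because the sides coincide by size if Y is above. It would then be A or B, of class `d`.
    other-heavy : ∀ {j s Y} → j ≢ d → Y ∈ Ys → ClassLabel j s Y → Heavy j (side s Y)
    other-heavy j≢d Y∈ (inj₁ heavy) = heavy
    other-heavy {j} {s} {Y} j≢d Y∈ (inj₂ (le , (E , E⊆ , e) , _)) with comparable Y∈ Y₀∈
    ... | inj₁ Y⊑Y₀ = contradiction (trans (sym e) (Y₀-class s E (⊆-trans E⊆ (side-mono s Y Y₀ Y⊑Y₀)))) j≢d
    ... | inj₂ Y₀⊑Y = contradiction (trans (sym e) (Y₀-class s E (subst (proj₁ E ⊆_) (sym same) E⊆))) j≢d
      where
      same : side s Y₀ ≡ side s Y
      same = ⊆∧∣∣≥⇒≡ (side-mono s Y₀ Y Y₀⊑Y) (≤-trans le (≤-reflexive (sym (PairLabel-side {X = Y₀} (t , A , B , a , b , A<B , A~B , sign) s))))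

    opposite-adjacent : ∀ {s Y Z} → Y ∈ Ys → Z ∈ Ys → (E C : Vertex) → proj₁ E ⊆ side s Y → proj₁ C ⊆ side (not s) Z → KAdj E C
    opposite-adjacent {s} {Y} {Z} Y∈ Z∈ E C E⊆ C⊆ with comparable Y∈ Z∈
    ... | inj₁ Y⊑Z = sides-disjoint s Z (⊆-trans E⊆ (side-mono s Y Z Y⊑Z)) C⊆
    ... | inj₂ Z⊑Y = sides-disjoint s Y E⊆ (⊆-trans C⊆ (side-mono (not s) Z Y Z⊑Y))

    -- A set of the even colour 2j+2 forces one of colour 2j+4 among the sets of class j+1 on
    -- the other side, of which at most one can have colour 2j+3.
    climb : ∀ i j → i + j ≡ m → d ≤ j → ∀ {Z} → Z ∈ Ys → (C : Vertex) →
      proj₁ C ⊆ side (not (flips (suc (k + k) + suc j) true)) Z → c C ≢ suc (suc (j + j))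
    -- Here j = m, and colour 2m+2 is one above the range.
    climb zero    j refl d≤j Z∈ C C⊆ e = <⇒≱ (≤-reflexive (sym e)) (proj₂ (c-range C))
    climb (suc i) j i+j  d≤j Z∈ C C⊆ e
      with classes (suc j) (≤-trans (s≤s (m≤n+m j i)) (≤-reflexive i+j))
    ... | Y , Y∈ , label with other-heavy (>⇒≢ (s≤s d≤j)) Y∈ label
    ...   | E , E′ , E≢E′ , (E⊆ , eE) , (E′⊆ , eE′) = cases (colours E eE) (colours E′ eE′)
      where
      colours : ∀ D → class D ≡ suc j → c D ≡ suc (suc (suc (j + j))) ⊎ c D ≡ suc (suc (suc j + suc j))
      colours D eD = Sum.map₁ (λ p → trans p (cong (λ z → suc (suc z)) (+-suc j j))) (c-cases D eD)
      next : ∀ D → proj₁ D ⊆ side (flips (suc (k + k) + suc j) true) Y → c D ≢ suc (suc (suc j + suc j))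
      next D D⊆ = climb i (suc j) (trans (+-suc i j) i+j) (m≤n⇒m≤1+n d≤j) Y∈ D (⊆-trans D⊆ (⊆-reflexive (cong (λ s → side s Y) turn)))
        where
        turn : flips (suc (k + k) + suc j) true ≡ not (flips (suc (k + k) + suc (suc j)) true)
        turn = sym (trans (cong (λ l → not (flips l true)) (+-suc (suc (k + k)) (suc j))) (not-involutive _))
      cases : c E ≡ suc (suc (suc (j + j))) ⊎ c E ≡ suc (suc (suc j + suc j)) →
        c E′ ≡ suc (suc (suc (j + j))) ⊎ c E′ ≡ suc (suc (suc j + suc j)) → ⊥
      cases (inj₂ eq) _ = next E E⊆ eq
      cases _ (inj₂ eq) = next E′ E′⊆ eq
      cases (inj₁ eq) (inj₁ eq′) = no-star E C E′ (suc (suc (j + j))) E≢E′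
        (opposite-adjacent Y∈ Z∈ E C E⊆ C⊆) (KAdj-sym E′ C (opposite-adjacent Y∈ Z∈ E′ C E′⊆ C⊆))
        (inj₂ eq) (inj₁ e) (inj₂ eq′)

    colour-B : c B ≡ suc (suc (d + d))
    colour-B with c-cases A refl | c-cases B (sym A~B)
    ... | _      | inj₂ q = q
    ... | inj₁ p | inj₁ q = contradiction A<B (<-irrefl (trans p (sym q)))
    ... | inj₂ p | inj₁ q = contradiction A<B (<⇒≯ (≤-reflexive (trans (cong suc q) (sym p))))

    -- Class d+1 stands d+2 places after the pair label, whose sign is `flips d t`, so an even
    -- number of flips remains. Hence class d+1 is on the side of A, opposite to B.
    t-sign : t ≡ flips (suc (k + k) + suc d) true
    t-sign = sym (begin
      not (flips (k + k + suc d) true)       ≡⟨ cong (λ l → not (flips l true)) (+-suc (k + k) d) ⟩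
      not (not (flips (k + k + d) true))     ≡⟨ not-involutive _ ⟩
      flips (k + k + d) true                 ≡⟨ cong (λ l → flips l true) (+-comm (k + k) d) ⟩
      flips (d + (k + k)) true               ≡⟨ flips-+ d (k + k) true ⟩
      flips d (flips (k + k) true)           ≡⟨ cong (flips d) sign ⟩
      flips d (flips d t)                    ≡⟨ flips-involutive d t ⟩
      t                                      ∎)

    chain-impossible : ⊥
    chain-impossible = climb (m ∸ d) d (m∸n+n≡m (class≤m A)) ≤-refl Y₀∈ B
      (⊆-reflexive (trans (sym b) (cong (λ s → side (not s) Y₀) t-sign))) colour-B

  pair-of : ∀ {Y l} → toℕ l ≡ k + k → ∀ {s} → Y HasLabel (l , s) → PairLabel s Y
  pair-of e (small lt _)     = contradiction lt (<-irrefl e)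
  pair-of e (pair _ p)       = p
  pair-of e (ofClass j e′ _) = contradiction (m≤m+n (suc (k + k)) j) (<⇒≱ (≤-reflexive (cong suc (trans (sym e′) e))))

  class-of : ∀ {Y l j} → toℕ l ≡ suc (k + k) + j → ∀ {s} → Y HasLabel (l , s) → ClassLabel j s Y
  class-of {j = j} e (small lt _) = contradiction (≤-trans (m≤n⇒m≤1+n (m≤m+n (k + k) j)) (≤-reflexive (sym e))) (<⇒≱ lt)
  class-of {j = j} e (pair e′ p)  = contradiction (m≤m+n (suc (k + k)) j) (<⇒≱ (≤-reflexive (cong suc (trans (sym e) e′))))
  class-of {Y} {j = j} e {s} (ofClass j′ e′ cl) =
    subst (λ j → ClassLabel j s Y) (+-cancelˡ-≡ (suc (k + k)) j′ j (trans (sym e′) e)) cl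

  impossible : ⊥
  impossible with kyFan N≤n
  ... | Ys , comparable , labels with labels (small-index ≤-refl)
  ...   | Y₀ , Y₀∈ , l₀ with subst (λ i → PairLabel (flips i true) Y₀) i≡ (pair-of i≡ l₀)
    where
    i≡ : toℕ (small-index (≤-refl {k + k})) ≡ k + k
    i≡ = toℕ-fromℕ< _
  ...     | t , A , B , a , b , A<B , A~B , sign =
    chain-impossible Ys comparable classes Y₀∈ {t} {A} {B} a b A<B A~B sign
    where
    classes : ∀ j → j ≤ m → ∃ λ Y → Y ∈ Ys × ClassLabel j (flips (suc (k + k) + j) true) Y
    classes j j≤m with labels (index j j≤m)
    ... | Y , Y∈ , l = Y , Y∈ ,
      subst (λ i → ClassLabel j (flips i true) Y) (toℕ-index j j≤m) (class-of {Y} (toℕ-index j j≤m) l)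

-- Lower bound and conclusion

lowerBound : ∀ m k → m ≤ k → ∀ t → HasStarFreeColoring (m + 2 * suc k) (suc k) t → 2 + (m + m) ≤ t
lowerBound m k m≤k t ((c , range) , starFree) with 2 + (m + m) ≤? t
... | yes le = le
-- Fewer than 2m+2 colours fit into the range up to 2m+1, and by `count` there are exactly as many
-- labels as coordinates.
... | no ¬le = ⊥-elim (LowerBound.impossible (m + 2 * suc k) k m m≤k (≤-reflexive (count m k)) c
    (λ A → proj₁ (range A) , ≤-trans (proj₂ (range A)) (s≤s⁻¹ (≰⇒> ¬le))) starFree)
  where
  count : ∀ m k → suc (k + k + suc m) ≡ m + 2 * suc k
  count = solve-∀

theorem3 : ∀ (n k : ℕ) → 1 ≤ k → 2 * k ≤ n → 4 ≤ 2 * k → 3 * n ≤ 8 * k →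
    StarChromaticNumberIs n k (2 * (n ∸ 2 * k + 2) ∸ 2)
theorem3 n (suc k) _ 2k≤n _ 3n≤8k = subst (λ t → StarChromaticNumberIs n (suc k) t) (sym (value m))
  (subst (λ n → StarChromaticNumberIs n (suc k) (2 + (m + m))) (m∸n+n≡m 2k≤n)
    (s≤s z≤n , starFreeColoring m k , λ t _ → lowerBound m k m≤k t))
  where
  m = n ∸ 2 * suc k
  value : ∀ m → 2 * (m + 2) ∸ 2 ≡ 2 + (m + m)
  value m = cong (_∸ 2) (expand m)
    where
    expand : ∀ m → 2 * (m + 2) ≡ 4 + (m + m)
    expand = solve-∀
  m≤k : m ≤ k
  -- Cancelling `6 * suc k` in the hypothesis leaves `3 * m ≤ 2 * suc k`, which is below
  -- `3 * suc k`.
  m≤k = s≤s⁻¹ (*-cancelˡ-< 3 m (suc k) (≤-<-trans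
    (+-cancelʳ-≤ (6 * suc k) (3 * m) (2 * suc k) (subst₂ _≤_
      (trans (cong (3 *_) (sym (m∸n+n≡m 2k≤n))) (left m k)) (right k) 3n≤8k))
    (*-monoˡ-< (suc k) (n<1+n 2))))
    where
    left : ∀ m k → 3 * (m + 2 * suc k) ≡ 3 * m + 6 * suc k
    left = solve-∀
    right : ∀ k → 8 * suc k ≡ 2 * suc k + 6 * suc k
    right = solve-∀
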